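{- In the needle in a haystack problem on $\{0,\dots,n-1\}$, for any sought number $s\in\{0,\dots,n-1\}$, the shift strategy satisfies $$\Pr[\mathcal V]\ \ge\ \frac{(1+o(1))\,\log n}{n\,\log\log n},$$ where $\mathcal V$ is the event that the sought number $s$ is found, i.e. that $\sigma(s+h \bmod n)=s$ for the hint $h$ of the shift strategy, and $o(1)$ is as $n\to\infty$.
   Context: $\log=\log_2$. Needle in a haystack problem: a permutation $\sigma$ of $\{0,\dots,n-1\}$ is chosen uniformly at random. A strategy is a pair of (possibly randomized) functions: a hint $h=h(\sigma)\in\{0,\dots,n-1\}$, chosen with knowledge of $\sigma$ but not of the sought number $s$, and an index $i=i(h,s)\in\{0,\dots,n-1\}$, chosen with knowledge only of $h$ and $s$. The sought number is found (event $\mathcal V$) if $\sigma(i)=s$. The probability is over the random choice of $\sigma$ and any randomness in the strategy; no assumption is made about $s$. Shift strategy: let $h\in\{0,\dots,n-1\}$ maximize $\big|\{\ell\in\{0,\dots,n-1\}: \ell=\sigma(\ell+h \bmod n)\}\big|$. In order to find the number $s$ in $\sigma$, check $\sigma(s+h \bmod n)$, i.e. take the index $i(h,s)=s+h \bmod n$.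
   Formalization: Ties between maximizing shifts h are assumed to be broken by a rule depending only on the numbers of matches of each shift (e.g. the least maximizer); with arbitrary σ-dependent tie-breaking, the bound for a fixed s fails for infinitely many n. -}

module Defs where

open import Data.Fin.Base using (Fin; toℕ)
import Data.Fin.Properties as Fin
open import Data.Integer.Base using (ℤ; +_; -[1+_])
open import Data.List.Base as List using (List; []; _∷_; length; filter; cartesianProductWith)
open import Data.List.Membership.Propositional using (_∈_)
open import Data.List.Membership.Propositional.Properties
  using (∈-allFin; ∈-filter⁺; ∈-cartesianProductWith⁺)
open import Data.List.Relation.Unary.Any using (here)
open import Data.Nat.Base as ℕ using (ℕ; zero; suc; NonZero)
open import Data.Nat.DivMod using (_mod_)
open import Data.Product.Base using (∃-syntax; _×_)
open import Data.Rational.Base as ℚ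
  using (ℚ; 0ℚ; 1ℚ; ½; _/_; _*_; _⊓_; _⊔_; _<_; ∣_∣; ↥_; ↧ₙ_)
open import Data.Vec.Base using (Vec; []; _∷_; lookup; allFin; count)
open import Data.Vec.Relation.Unary.AllPairs using (allPairs?)
open import Data.Vec.Relation.Unary.Unique.Propositional using (Unique)
open import Data.Vec.Relation.Unary.Unique.Propositional.Properties using (tabulate⁺)
open import Algebra.Definitions.RawSemiring ℚ.+-*-rawSemiring using (_^_)
open import Function.Base using (id)
open import Relation.Binary.PropositionalEquality.Core using (_≡_; refl)
open import Relation.Nullary.Decidable using (¬?)
open import Relation.Unary using (Pred; Decidable)
open import Level using (0ℓ)

-- Real numbers as Dedekind cuts; only the two halves are recorded: `lower q` means q < x and
-- `upper q` means x < q.  No laws are required: every real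
-- number below is built from rationals by explicit formulas.

record ℝ : Set₁ where
  constructor cut
  field
    lower : Pred ℚ 0ℓ
    upper : Pred ℚ 0ℓ

open ℝ public

infix  4 _≤ᴿ_ _≥ᴿ_
infixl 7 _*ᴿ_ _/ᴿ_

_≤ᴿ_ : ℝ → ℝ → Set
x ≤ᴿ y = ∀ q → lower x q → lower y q

_≥ᴿ_ : ℝ → ℝ → Set
x ≥ᴿ y = y ≤ᴿ x

fromℚ : ℚ → ℝ
fromℚ p = cut (_< p) (p <_)

fromℕ : ℕ → ℝ
fromℕ n = fromℚ (+ n / 1)

-- Interval multiplication, valid for arbitrary signs.

_*ᴿ_ : ℝ → ℝ → ℝ
x *ᴿ y = cut
  (λ q → ∃[ a ] ∃[ b ] ∃[ c ] ∃[ d ]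
     lower x a × upper x b × lower y c × upper y d ×
     q < (a * c) ⊓ (a * d) ⊓ (b * c) ⊓ (b * d))
  (λ q → ∃[ a ] ∃[ b ] ∃[ c ] ∃[ d ]
     lower x a × upper x b × lower y c × upper y d ×
     (a * c) ⊔ (a * d) ⊔ (b * c) ⊔ (b * d) < q)

-- The reciprocal of y; meaningful only for y > 0.

recip : ℝ → ℝ
recip y = cut
  (λ q → ∃[ r ] upper y r × q * r < 1ℚ)
  (λ q → ∃[ r ] lower y r × 0ℚ < r × 1ℚ < q * r)

_/ᴿ_ : ℝ → ℝ → ℝ
x /ᴿ y = x *ᴿ recip y

2^_ : ℤ → ℚ
2^ (+ n)    = (+ 2 / 1) ^ n
2^ -[1+ n ] = ½ ^ suc n

-- The binary logarithm of x; meaningful only for x > 0.  For rational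
-- q = m/d and r > 0, the comparison of 2^q with r is that of 2^m with r^d.

log₂ : ℝ → ℝ
log₂ x = cut
  (λ q → ∃[ r ] lower x r × 0ℚ < r × 2^ (↥ q) < r ^ ↧ₙ q)
  (λ q → ∃[ r ] upper x r × 0ℚ < r × r ^ ↧ₙ q < 2^ (↥ q))

infix 4 _⟶0

_⟶0 : (ℕ → ℚ) → Set
δ ⟶0 = ∀ ε → 0ℚ < ε → ∃[ N ] ∀ n → N ℕ.≤ n → ∣ δ n ∣ < ε

-- A permutation σ is given in one-line notation, as the vector of its
-- values σ(0), …, σ(n−1), which have to be distinct.

words : ∀ k n → List (Vec (Fin n) k)
words zero    n = [] ∷ []
words (suc k) n = cartesianProductWith _∷_ (List.allFin n) (words k n)

unique? : ∀ {k n} → Decidable (Unique {A = Fin n} {k})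
unique? = allPairs? (λ x y → ¬? (x Fin.≟ y))

permutations : ∀ n → List (Vec (Fin n) n)
permutations n = filter unique? (words n n)

∈-words : ∀ {k n} (w : Vec (Fin n) k) → w ∈ words k n
∈-words []      = here refl
∈-words (x ∷ w) = ∈-cartesianProductWith⁺ _∷_ (∈-allFin x) (∈-words w)

permutations-nonZero : ∀ n → NonZero (length (permutations n))
permutations-nonZero n =
  nonEmpty (∈-filter⁺ unique? (∈-words (allFin n)) (tabulate⁺ id))
  where
  nonEmpty : ∀ {A : Set} {x : A} {xs} → x ∈ xs → NonZero (length xs)
  nonEmpty {xs = _ ∷ _} _ = _

Pr : ∀ {n} {P : Pred (Vec (Fin n) n) 0ℓ} → Decidable P → ℚ
Pr {n} P? = + length (filter P? (permutations n)) / length (permutations n)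
  where instance _ = permutations-nonZero n

module _ {n : ℕ} .{{_ : NonZero n}} where

  infixl 6 _⊕_

  _⊕_ : Fin n → Fin n → Fin n
  i ⊕ h = (toℕ i ℕ.+ toℕ h) mod n

  shiftCount : Vec (Fin n) n → Fin n → ℕ
  shiftCount σ h = count (λ ℓ → ℓ Fin.≟ lookup σ (ℓ ⊕ h)) (allFin n)

-- Ties between maximizing shifts may be broken by any rule that looks only
-- at the counts (such as taking the least maximizer).  A rule looking at σ
-- itself could discriminate against a particular sought number, e.g. by
-- avoiding, whenever there is a choice, the one shift that finds it.

record ShiftHint (n : ℕ) .{{_ : NonZero n}} : Set where
  field
    hint      : Vec (Fin n) n → Fin n
    maximizes : ∀ {σ} → Unique σ → ∀ k → shiftCount σ k ℕ.≤ shiftCount σ (hint σ)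
    tieBreak  : ∀ {σ τ} → Unique σ → Unique τ →
                (∀ k → shiftCount σ k ≡ shiftCount τ k) → hint σ ≡ hint τ

open ShiftHint public

module _ {n : ℕ} .{{_ : NonZero n}} (H : ShiftHint n) (s : Fin n) where

  Found : Pred (Vec (Fin n) n) 0ℓ
  Found σ = lookup σ (s ⊕ hint H σ) ≡ s

  found? : Decidable Found
  found? σ = lookup σ (s ⊕ hint H σ) Fin.≟ s

{-# OPTIONS --safe #-}
-- Conjugating σ by a shift of ℤ/n permutes the sought numbers and preserves all counts, hence
-- the hint, so all s are found equally often and n Pr[V] is the expected maximum over the shifts
-- h of the number C_h of matches ℓ = σ(ℓ + h).  Let X be the sum over h of the falling
-- factorials of length k of C_h.  Then E X = n exactly and, since matches under distinct shifts are
-- nearly independent, E X² ≤ n² (1 + 1/(2k)) + n (2k+1)^k when 4k² (2k+1) ≤ n.  As 1[X>0] is at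
-- least 2X/n − (X/n)², the expected maximum is at least k − 1 if also 2k (2k+1)^k ≤ n.  Both hold for
-- k = ⌊m / (ℓ + 3)⌋ with m = ⌊log n⌋ and ℓ = ⌊log m⌋ ≥ 5, which gives 1 + o(1) = (ℓ ∸ 4) / (ℓ + 1).

module Submission where

open import Defs
open import Data.Fin.Base as Fin using (Fin; toℕ)
import Data.Fin.Properties as Fin
open import Relation.Binary.PropositionalEquality
open import Relation.Nullary.Decidable using (Dec; does; yes; no; dec-true; dec-false)
open import Relation.Nullary.Negation using (¬_; contradiction)
open import Function.Base using (_∘_; id)

-- The maximum itself has no tractable mean, but sums over all permutations of products of match
-- indicators are counts of permutations with prescribed values. A falling factorial of length k is
-- a sum of such products, vanishes exactly when there are fewer than k matches, and is always the
-- sum over ordered tuples of distinct cells, so no moment has to be expanded into Stirling numbers.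
-- Under one shift, distinct matches never compete for a position or a value, which makes the mean
-- of X exact. Under two shifts they may compete, and then no permutation obeys both. Such conflicts
-- only lower the count, and E X² is needed only from above. All of this stays in ℕ: probabilities
-- are counts of permutations, and the denominator `n P′ (k + k)` is multiplied through instead of
-- divided by.

module Counting where

  open import Data.Bool.Base using (true; false; if_then_else_)
  open import Data.Fin.Permutation.Components using (transpose; transpose-inverse)
  open import Data.List.Base as List using (List; []; _∷_; _++_; length; map; filter; replicate)
  import Data.List.Membership.DecPropositional as DecMembership
  open import Data.List.Membership.Propositional using (_∈_; _∉_)
  open import Data.List.Membership.Propositional.Properties
    using (∈-map⁺; ∈-map⁻; ∈-allFin; ∈-filter⁺; ∈-filter⁻)
  open import Data.List.Membership.Propositional.Properties.WithK using (unique∧set⇒bag)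
  open import Data.List.Properties using (map-∘; length-tabulate; length-map; length-++; length-replicate)
  open import Data.List.Relation.Binary.BagAndSetEquality using (∼bag⇒↭)
  import Data.List.Relation.Binary.Permutation.Propositional.Properties as ↭
  import Data.List.Relation.Unary.All as All
  open import Data.List.Relation.Unary.All.Properties using (¬Any⇒All¬)
  import Data.List.Relation.Unary.AllPairs as AP
  open import Data.List.Relation.Unary.Any using (here; there)
  open import Data.List.Relation.Unary.Unique.Propositional using () renaming (Unique to UniqueL)
  import Data.List.Relation.Unary.Unique.Propositional.Properties as UL
  open import Data.Nat.Base
  open import Data.Nat.Combinatorics.Base using (_P′_)
  open import Data.Nat.Combinatorics.Specification using (nP′k≡n[n∸1P′k∸1])
  open import Data.Nat.DivMod
  import Data.Nat.ListAction as ℕL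
  open import Data.Nat.ListAction.Properties using (sum-↭)
  open import Data.Nat.Logarithm
    using (⌊log₂_⌋; ⌊log₂⌋-mono-≤; ⌊log₂[2^n]⌋≡n; ⌊log₂⌊n/2⌋⌋≡⌊log₂n⌋∸1)
  open import Data.Nat.Properties
  open import Data.Nat.Solver using (module +-*-Solver)
  open import Data.Product.Base using (_,_; _×_; proj₁; proj₂)
  open import Data.Product.Properties using (≡-dec)
  open import Data.Sum.Base using (_⊎_; inj₁; inj₂)
  open import Data.Vec.Base as Vec using (Vec; []; _∷_; lookup)
  open import Data.Vec.Properties as Vec
    using (∷-injective; lookup-map; lookup∘tabulate; tabulate-cong; tabulate∘lookup)
  open import Data.Vec.Relation.Unary.Unique.Propositional using (Unique)
  import Data.Vec.Relation.Unary.Unique.Propositional.Properties as UV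
  open import Function.Bundles using (mk⇔)
  open import Relation.Binary.Definitions using (DecidableEquality)
  open import Relation.Unary using (Pred; Decidable)
  open +-*-Solver using (solve; _:=_; _:+_; _:*_; con)

  -- Finite sums

  private variable
    A B : Set

  ∑ : List A → (A → ℕ) → ℕ
  ∑ xs f = ℕL.sum (map f xs)

  ⟦_⟧ : ∀ {P : Set} → Dec P → ℕ
  ⟦ P? ⟧ = if does P? then 1 else 0

  ⟦⟧-yes : ∀ {P : Set} (P? : Dec P) → P → ⟦ P? ⟧ ≡ 1
  ⟦⟧-yes P? p rewrite dec-true P? p = refl

  ⟦⟧-no : ∀ {P : Set} (P? : Dec P) → ¬ P → ⟦ P? ⟧ ≡ 0
  ⟦⟧-no P? ¬p rewrite dec-false P? ¬p = refl

  ⟦⟧-cong : ∀ {P Q : Set} (P? : Dec P) (Q? : Dec Q) → (P → Q) → (Q → P) → ⟦ P? ⟧ ≡ ⟦ Q? ⟧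
  ⟦⟧-cong (yes p) Q? f g = sym (⟦⟧-yes Q? (f p))
  ⟦⟧-cong (no ¬p) Q? f g = sym (⟦⟧-no Q? (¬p ∘ g))

  ∑-mono-∈ : ∀ (xs : List A) {f g : A → ℕ} → (∀ {x} → x ∈ xs → f x ≤ g x) → ∑ xs f ≤ ∑ xs g
  ∑-mono-∈ []       h = z≤n
  ∑-mono-∈ (x ∷ xs) h = +-mono-≤ (h (here refl)) (∑-mono-∈ xs (h ∘ there))

  ∑-cong-∈ : ∀ (xs : List A) {f g : A → ℕ} → (∀ {x} → x ∈ xs → f x ≡ g x) → ∑ xs f ≡ ∑ xs g
  ∑-cong-∈ xs h = ≤-antisym (∑-mono-∈ xs (≤-reflexive ∘ h)) (∑-mono-∈ xs (≤-reflexive ∘ sym ∘ h))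

  ∑-mono : ∀ (xs : List A) {f g : A → ℕ} → (∀ x → f x ≤ g x) → ∑ xs f ≤ ∑ xs g
  ∑-mono xs h = ∑-mono-∈ xs (λ {x} _ → h x)

  ∑-cong : ∀ (xs : List A) {f g : A → ℕ} → (∀ x → f x ≡ g x) → ∑ xs f ≡ ∑ xs g
  ∑-cong xs h = ∑-cong-∈ xs (λ {x} _ → h x)

  ∑-const : ∀ (xs : List A) c → ∑ xs (λ _ → c) ≡ length xs * c
  ∑-const []       c = refl
  ∑-const (x ∷ xs) c = cong (c +_) (∑-const xs c)

  ∑-+ : ∀ (xs : List A) (f g : A → ℕ) → ∑ xs (λ x → f x + g x) ≡ ∑ xs f + ∑ xs g
  ∑-+ []       f g = refl
  ∑-+ (x ∷ xs) f g rewrite ∑-+ xs f g =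
    solve 4 (λ a b c d → a :+ b :+ (c :+ d) := a :+ c :+ (b :+ d)) refl (f x) (g x) (∑ xs f) (∑ xs g)

  *-∑ : ∀ (xs : List A) c (f : A → ℕ) → c * ∑ xs f ≡ ∑ xs (λ x → c * f x)
  *-∑ []       c f = *-zeroʳ c
  *-∑ (x ∷ xs) c f rewrite *-distribˡ-+ c (f x) (∑ xs f) = cong (c * f x +_) (*-∑ xs c f)

  ∑-* : ∀ (xs : List A) c (f : A → ℕ) → ∑ xs f * c ≡ ∑ xs (λ x → f x * c)
  ∑-* xs c f = trans (*-comm (∑ xs f) c) (trans (*-∑ xs c f) (∑-cong xs (λ x → *-comm c (f x))))

  ∑-swap : ∀ (xs : List A) (ys : List B) (f : A → B → ℕ) →
           ∑ xs (λ x → ∑ ys (f x)) ≡ ∑ ys (λ y → ∑ xs (λ x → f x y))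
  ∑-swap []       ys f = sym (trans (∑-const ys 0) (*-zeroʳ (length ys)))
  ∑-swap (x ∷ xs) ys f = trans (cong (∑ ys (f x) +_) (∑-swap xs ys f)) (sym (∑-+ ys (f x) _))

  ∑-∈-≤ : ∀ {xs : List A} (f : A → ℕ) {x} → x ∈ xs → f x ≤ ∑ xs f
  ∑-∈-≤ f (here refl) = m≤m+n _ _
  ∑-∈-≤ f (there x∈)  = m≤n⇒m≤o+n _ (∑-∈-≤ f x∈)

  ∑-filter : ∀ {P : Pred A _} (P? : Decidable P) xs → length (filter P? xs) ≡ ∑ xs (λ x → ⟦ P? x ⟧)
  ∑-filter P? [] = refl
  ∑-filter P? (x ∷ xs) with does (P? x)
  ... | true  = cong suc (∑-filter P? xs)
  ... | false = ∑-filter P? xs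

  ∑-⟦≡⟧ : ∀ (_≟_ : DecidableEquality A) {xs} (y : A) → UniqueL xs → y ∈ xs → ∑ xs (λ x → ⟦ y ≟ x ⟧) ≡ 1
  ∑-⟦≡⟧ _≟_ {x ∷ xs} y u (here refl) rewrite ⟦⟧-yes (y ≟ y) refl = cong suc
    (trans (∑-cong-∈ xs (λ {z} z∈ → ⟦⟧-no (y ≟ z) (λ { refl → UL.Unique[x∷xs]⇒x∉xs u z∈ })))
           (trans (∑-const xs 0) (*-zeroʳ (length xs))))
  ∑-⟦≡⟧ _≟_ {x ∷ xs} y u@(_ AP.∷ u′) (there y∈)
    rewrite ⟦⟧-no (y ≟ x) (λ { refl → UL.Unique[x∷xs]⇒x∉xs u y∈ }) = ∑-⟦≡⟧ _≟_ y u′ y∈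

  -- Duplicate-free lists with the same members are permutations of each other. Here they are `xs`
  -- and `map φ xs`, with `ψ` supplying preimages inside `xs`.
  ∑-reindex : ∀ {xs : List A} (φ ψ : A → A) → UniqueL xs →
              (∀ {x} → x ∈ xs → φ x ∈ xs) → (∀ {x} → x ∈ xs → ψ x ∈ xs) →
              (∀ x → φ (ψ x) ≡ x) → (∀ x → ψ (φ x) ≡ x) →
              ∀ f → ∑ xs (f ∘ φ) ≡ ∑ xs f
  ∑-reindex {xs = xs} φ ψ u φ∈ ψ∈ φψ ψφ f =
    trans (cong ℕL.sum (map-∘ xs)) (sum-↭ (↭.map⁺ f (∼bag⇒↭ bag)))
    where
    to : ∀ {x} → x ∈ map φ xs → x ∈ xs
    to x∈ with ∈-map⁻ φ x∈
    ... | y , y∈ , refl = φ∈ y∈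
    from : ∀ {x} → x ∈ xs → x ∈ map φ xs
    from {x} x∈ = subst (_∈ map φ xs) (φψ x) (∈-map⁺ φ (ψ∈ x∈))
    bag = unique∧set⇒bag
      (UL.map⁺ (λ {x} {y} eq → trans (sym (ψφ x)) (trans (cong ψ eq) (ψφ y))) u) u (mk⇔ to from)

  ∑ᶠ : ∀ {n} → (Fin n → ℕ) → ℕ
  ∑ᶠ {n} = ∑ (List.allFin n)

  ∑ᶠ-const : ∀ n c → ∑ᶠ {n} (λ _ → c) ≡ n * c
  ∑ᶠ-const n c = trans (∑-const (List.allFin n) c) (cong (_* c) (length-tabulate {n = n} (λ i → i)))

  ∑ᶠ-⟦≡⟧ : ∀ {n} (y : Fin n) → ∑ᶠ (λ x → ⟦ y Fin.≟ x ⟧) ≡ 1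
  ∑ᶠ-⟦≡⟧ {n} y = ∑-⟦≡⟧ Fin._≟_ y (UL.allFin⁺ n) (∈-allFin y)

  -- The reindexing `g` is there for the induction: the tail of an enumeration of `Fin` is tabulated
  -- by `Fin.suc`, and `g` accumulates these.
  count-∑ : ∀ {n k} {P : Pred A _} (P? : Decidable P) (g : Fin n → Fin k) (f : Fin k → A) →
            Vec.count P? (Vec.tabulate (f ∘ g)) ≡ ∑ (List.tabulate g) (λ i → ⟦ P? (f i) ⟧)
  count-∑ {n = zero}  P? g f = refl
  count-∑ {n = suc n} P? g f with does (P? (f (g Fin.zero)))
  ... | true  = cong suc (count-∑ P? (g ∘ Fin.suc) f)
  ... | false = count-∑ P? (g ∘ Fin.suc) f

  -- Permutations with prescribed values

  words-unique : ∀ k n → UniqueL (words k n)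
  words-unique zero    n = All.[] AP.∷ AP.[]
  words-unique (suc k) n =
    UL.cartesianProductWith⁺ _∷_ ∷-injective (UL.allFin⁺ n) (words-unique k n)

  permutations-unique : ∀ n → UniqueL (permutations n)
  permutations-unique n = UL.filter⁺ unique? (words-unique n n)

  ∈-permutations⁺ : ∀ {n} {σ : Vec (Fin n) n} → Unique σ → σ ∈ permutations n
  ∈-permutations⁺ {σ = σ} u = ∈-filter⁺ unique? (∈-words σ) u

  ∈-permutations⁻ : ∀ {n} {σ : Vec (Fin n) n} → σ ∈ permutations n → Unique σ
  ∈-permutations⁻ {n} σ∈ = proj₂ (∈-filter⁻ unique? {xs = words n n} σ∈)

  -- A list of cells (a , b) prescribes the values σ(a) = b; `hits P σ` is the
  -- indicator that σ obeys all of them.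
  Cell : ℕ → Set
  Cell n = Fin n × Fin n

  module _ {n : ℕ} where

    open DecMembership (Fin._≟_ {n}) using (_∈?_; _∉?_)

    at : Cell n → Vec (Fin n) n → ℕ
    at (a , b) σ = ⟦ lookup σ a Fin.≟ b ⟧

    hits : List (Cell n) → Vec (Fin n) n → ℕ
    hits []      σ = 1
    hits (c ∷ P) σ = at c σ * hits P σ

    ∑ₚ : (Vec (Fin n) n → ℕ) → ℕ
    ∑ₚ = ∑ (permutations n)

    at-no : ∀ {a b} σ → lookup σ a ≢ b → at (a , b) σ ≡ 0
    at-no {a} {b} σ = ⟦⟧-no (lookup σ a Fin.≟ b)

    at*hits≡0 : ∀ {a b a′ b′} P σ → (a′ , b′) ∈ P → (lookup σ a ≡ b → lookup σ a′ ≢ b′) →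
                hits ((a , b) ∷ P) σ ≡ 0
    at*hits≡0 {a} {b} {a′} {b′} P σ c∈ h with lookup σ a Fin.≟ b
    ... | no _  = refl
    ... | yes e = trans (+-identityʳ _) (go P c∈)
      where
      go : ∀ P → (a′ , b′) ∈ P → hits P σ ≡ 0
      go (_ ∷ P) (here refl) rewrite at-no σ (h e) = refl
      go (c ∷ P) (there c∈) rewrite go P c∈ = *-zeroʳ (at c σ)

    transpose-at : (b b′ : Fin n) → transpose b b′ b ≡ b′
    transpose-at b b′ rewrite dec-true (b Fin.≟ b) refl = refl

    transpose-away : (b b′ x : Fin n) → x ≢ b → x ≢ b′ → transpose b b′ x ≡ x
    transpose-away b b′ x ≢b ≢b′ rewrite dec-false (x Fin.≟ b) ≢b | dec-false (x Fin.≟ b′) ≢b′ = refl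

    transpose-injective : ∀ (b b′ : Fin n) {x y} → transpose b b′ x ≡ transpose b b′ y → x ≡ y
    transpose-injective b b′ {x} {y} eq = trans (sym (transpose-inverse b′ b))
      (trans (cong (transpose b′ b) eq) (transpose-inverse b′ b))

    ∑ₚ-relabel : ∀ (b b′ : Fin n) f → ∑ₚ (f ∘ Vec.map (transpose b b′)) ≡ ∑ₚ f
    ∑ₚ-relabel b b′ = ∑-reindex _ _ (permutations-unique n) (closed b b′) (closed b′ b)
      (inverse b b′) (inverse b′ b)
      where
      closed : ∀ b b′ {σ} → σ ∈ permutations n → Vec.map (transpose b b′) σ ∈ permutations n
      closed b b′ σ∈ = ∈-permutations⁺ (UV.map⁺ (transpose-injective b b′) (∈-permutations⁻ σ∈))
      inverse : ∀ b b′ (σ : Vec (Fin n) n) → Vec.map (transpose b b′) (Vec.map (transpose b′ b) σ) ≡ σ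
      inverse b b′ σ = trans (sym (Vec.map-∘ _ _ σ))
        (trans (Vec.map-cong (λ x → transpose-inverse b b′) σ) (Vec.map-id σ))

    at-relabel : ∀ b b′ {a y y′} σ → transpose b b′ y ≡ y′ →
                 at (a , y′) (Vec.map (transpose b b′) σ) ≡ at (a , y) σ
    at-relabel b b′ {a} {y} σ refl rewrite lookup-map a (transpose b b′) σ =
      ⟦⟧-cong (transpose b b′ (lookup σ a) Fin.≟ transpose b b′ y) (lookup σ a Fin.≟ y)
          (transpose-injective b b′) (cong (transpose b b′))

    hits-relabel : ∀ b b′ P σ → b ∉ map proj₂ P → b′ ∉ map proj₂ P →
                   hits P (Vec.map (transpose b b′) σ) ≡ hits P σ
    hits-relabel b b′ [] σ b∉ b′∉ = refl
    hits-relabel b b′ ((x , y) ∷ P) σ b∉ b′∉ = cong₂ _*_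
      (at-relabel b b′ σ (transpose-away b b′ y (λ { refl → b∉ (here refl) }) (λ { refl → b′∉ (here refl) })))
      (hits-relabel b b′ P σ (b∉ ∘ there) (b′∉ ∘ there))

    -- Swapping the values `b` and `b′` is a bijection between the permutations sending `a` to `b`
    -- and those sending it to `b′`. It disturbs no cell of `P`, because neither value occurs there.
    ∑ₚ-hits-exchange : ∀ {a} b b′ P → b ∉ map proj₂ P → b′ ∉ map proj₂ P →
                       ∑ₚ (hits ((a , b′) ∷ P)) ≡ ∑ₚ (hits ((a , b) ∷ P))
    ∑ₚ-hits-exchange {a} b b′ P b∉ b′∉ = trans (sym (∑ₚ-relabel b b′ (hits ((a , b′) ∷ P))))
      (∑-cong (permutations n) (λ σ → cong₂ _*_ (at-relabel b b′ {a} σ (transpose-at b b′))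
        (hits-relabel b b′ P σ b∉ b′∉)))

    ∑-∉ : ∀ (bs : List (Fin n)) → UniqueL bs → ∑ᶠ (λ b → ⟦ b ∉? bs ⟧) + length bs ≡ n
    ∑-∉ [] _ = trans (+-identityʳ _) (trans (∑ᶠ-const n 1) (*-identityʳ n))
    ∑-∉ (c ∷ bs) u@(_ AP.∷ u′) = begin
      ∑ᶠ (λ b → ⟦ b ∉? c ∷ bs ⟧) + suc (length bs)
        ≡⟨ +-suc _ _ ⟩
      1 + ∑ᶠ (λ b → ⟦ b ∉? c ∷ bs ⟧) + length bs
        ≡⟨ cong (λ t → t + ∑ᶠ (λ b → ⟦ b ∉? c ∷ bs ⟧) + length bs) (sym (∑ᶠ-⟦≡⟧ c)) ⟩
      ∑ᶠ (λ b → ⟦ c Fin.≟ b ⟧) + ∑ᶠ (λ b → ⟦ b ∉? c ∷ bs ⟧) + length bs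
        ≡⟨ cong (_+ length bs) (sym (∑-+ (List.allFin n) _ _)) ⟩
      ∑ᶠ (λ b → ⟦ c Fin.≟ b ⟧ + ⟦ b ∉? c ∷ bs ⟧) + length bs
        ≡⟨ cong (_+ length bs) (∑-cong (List.allFin n) split) ⟩
      ∑ᶠ (λ b → ⟦ b ∉? bs ⟧) + length bs
        ≡⟨ ∑-∉ bs u′ ⟩
      n ∎
      where
      open ≡-Reasoning
      split : ∀ b → ⟦ c Fin.≟ b ⟧ + ⟦ b ∉? c ∷ bs ⟧ ≡ ⟦ b ∉? bs ⟧
      split b with c Fin.≟ b
      ... | yes refl = trans (cong suc (⟦⟧-no (c ∉? c ∷ bs) (λ c∉ → c∉ (here refl))))
                             (sym (⟦⟧-yes (c ∉? bs) (UL.Unique[x∷xs]⇒x∉xs u)))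
      ... | no c≢b   = ⟦⟧-cong (b ∉? c ∷ bs) (b ∉? bs) (_∘ there)
                         (λ { b∉ (here b≡c) → c≢b (sym b≡c) ; b∉ (there b∈) → b∉ b∈ })

    -- All admissible values at a fresh position are equally likely.
    ∑ₚ-hits-extend : ∀ {a b} P → UniqueL (map proj₂ P) → a ∉ map proj₁ P → b ∉ map proj₂ P →
                     ∑ᶠ (λ y → ⟦ y ∉? map proj₂ P ⟧) * ∑ₚ (hits ((a , b) ∷ P)) ≡ ∑ₚ (hits P)
    ∑ₚ-hits-extend {a} {b} P u a∉ b∉ = begin
      ∑ᶠ (λ y → ⟦ y ∉? map proj₂ P ⟧) * ∑ₚ (hits ((a , b) ∷ P))
        ≡⟨ ∑-* (List.allFin n) _ _ ⟩
      ∑ᶠ (λ y → ⟦ y ∉? map proj₂ P ⟧ * ∑ₚ (hits ((a , b) ∷ P)))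
        ≡⟨ ∑-cong (List.allFin n) eachValue ⟩
      ∑ᶠ (λ y → ∑ₚ (hits ((a , y) ∷ P)))
        ≡⟨ sym (∑-swap (permutations n) (List.allFin n) _) ⟩
      ∑ₚ (λ σ → ∑ᶠ (λ y → at (a , y) σ * hits P σ))
        ≡⟨ ∑-cong (permutations n) (λ σ → trans (sym (∑-* (List.allFin n) (hits P σ) _))
             (trans (cong (_* hits P σ) (∑ᶠ-⟦≡⟧ (lookup σ a))) (+-identityʳ _))) ⟩
      ∑ₚ (hits P) ∎
      where
      open ≡-Reasoning
      eachValue : ∀ y → ⟦ y ∉? map proj₂ P ⟧ * ∑ₚ (hits ((a , b) ∷ P)) ≡ ∑ₚ (hits ((a , y) ∷ P))
      eachValue y with y ∈? map proj₂ P
      ... | no y∉  = trans (+-identityʳ _) (∑ₚ-hits-exchange y b P y∉ b∉)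
      ... | yes y∈ with ∈-map⁻ proj₂ y∈
      ...   | (a′ , _) , c∈ , refl = sym (trans
        (∑-cong-∈ (permutations n) {g = λ _ → 0} (λ {σ} σ∈ → at*hits≡0 P σ c∈ (λ e e′ →
          a∉ (subst (_∈ map proj₁ P)
            (UV.lookup-injective (∈-permutations⁻ σ∈) a′ a (trans e′ (sym e))) (∈-map⁺ proj₁ c∈)))))
        (trans (∑-const (permutations n) 0) (*-zeroʳ (length (permutations n)))))

  -- Factorial moments of the number of matches

  #permutations : ℕ → ℕ
  #permutations n = length (permutations n)

  module _ {n : ℕ} where

    open DecMembership (Fin._≟_ {n}) using (_∈?_; _∉?_)

    ∑ₚ-1 : ∑ₚ {n} (λ _ → 1) ≡ #permutations n
    ∑ₚ-1 = trans (∑-const (permutations n) 1) (*-identityʳ _)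

    ∑ₚ-0 : ∀ {f : Vec (Fin n) n → ℕ} → (∀ {σ} → Unique σ → f σ ≡ 0) → ∑ₚ f ≡ 0
    ∑ₚ-0 h = trans (∑-cong-∈ (permutations n) {g = λ _ → 0} (h ∘ ∈-permutations⁻))
      (trans (∑-const (permutations n) 0) (*-zeroʳ (#permutations n)))

    ∑ₚ-hits-∷ : ∀ {a b} (P : List (Cell n)) → UniqueL (map proj₂ P) → a ∉ map proj₁ P → b ∉ map proj₂ P →
                (n ∸ length P) * ∑ₚ (hits ((a , b) ∷ P)) ≡ ∑ₚ (hits P)
    ∑ₚ-hits-∷ {a} {b} P u a∉ b∉ = trans (cong (_* ∑ₚ (hits ((a , b) ∷ P))) count) (∑ₚ-hits-extend P u a∉ b∉)
      where
      count : n ∸ length P ≡ ∑ᶠ (λ y → ⟦ y ∉? map proj₂ P ⟧)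
      count = trans (cong₂ _∸_ (sym (∑-∉ (map proj₂ P) u)) (sym (length-map proj₂ P)))
        (m+n∸n≡m _ (length (map proj₂ P)))

    -- Each new cell divides the number of obeying permutations by the number of values still free,
    -- and these divisors multiply to the falling factorial.
    ∑ₚ-hits-compatible : ∀ (P : List (Cell n)) → UniqueL (map proj₁ P) → UniqueL (map proj₂ P) →
                         ∑ₚ (hits P) * (n P′ length P) ≡ #permutations n
    ∑ₚ-hits-compatible [] _ _ = trans (*-identityʳ _) ∑ₚ-1
    ∑ₚ-hits-compatible (c ∷ P) u₁@(_ AP.∷ u₁′) u₂@(_ AP.∷ u₂′) = begin
      ∑ₚ (hits (c ∷ P)) * ((n ∸ length P) * (n P′ length P))
        ≡⟨ solve 3 (λ a b c → a :* (b :* c) := b :* a :* c) refl (∑ₚ (hits (c ∷ P))) (n ∸ length P) (n P′ length P) ⟩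
      (n ∸ length P) * ∑ₚ (hits (c ∷ P)) * (n P′ length P)
        ≡⟨ cong (_* (n P′ length P)) (∑ₚ-hits-∷ P u₂′ (UL.Unique[x∷xs]⇒x∉xs u₁) (UL.Unique[x∷xs]⇒x∉xs u₂)) ⟩
      ∑ₚ (hits P) * (n P′ length P)
        ≡⟨ ∑ₚ-hits-compatible P u₁′ u₂′ ⟩
      #permutations n ∎
      where open ≡-Reasoning

    -- Distinct cells with a common position demand two values there, and distinct cells with a
    -- common value contradict injectivity. A list of distinct cells is therefore a partial
    -- injection unless no permutation obeys it.
    compatible-or-unhit : ∀ (P : List (Cell n)) → UniqueL P →
      (UniqueL (map proj₁ P) × UniqueL (map proj₂ P)) ⊎ (∀ {σ} → Unique σ → hits P σ ≡ 0)
    compatible-or-unhit [] _ = inj₁ (AP.[] , AP.[])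
    compatible-or-unhit ((a , b) ∷ P) u@(_ AP.∷ u′) with compatible-or-unhit P u′
    ... | inj₂ z = inj₂ (λ {σ} uσ → trans (cong (at (a , b) σ *_) (z uσ)) (*-zeroʳ (at (a , b) σ)))
    ... | inj₁ (u₁ , u₂) with a ∈? map proj₁ P | b ∈? map proj₂ P
    ...   | no a∉  | no b∉ = inj₁ (¬Any⇒All¬ _ a∉ AP.∷ u₁ , ¬Any⇒All¬ _ b∉ AP.∷ u₂)
    ...   | yes a∈ | _ with ∈-map⁻ proj₁ a∈
    ...     | (_ , b′) , c∈ , refl = inj₂ (λ {σ} uσ → at*hits≡0 P σ c∈ (λ e e′ →
                UL.Unique[x∷xs]⇒x∉xs u (subst (λ t → (a , t) ∈ P) (trans (sym e′) e) c∈)))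
    compatible-or-unhit ((a , b) ∷ P) u@(_ AP.∷ u′) | inj₁ (u₁ , u₂) | no _ | yes b∈ with ∈-map⁻ proj₂ b∈
    ...     | (a′ , _) , c∈ , refl = inj₂ (λ {σ} uσ → at*hits≡0 P σ c∈ (λ e e′ →
                UL.Unique[x∷xs]⇒x∉xs u (subst (λ t → (t , b) ∈ P)
                  (UV.lookup-injective uσ a′ a (trans e′ (sym e))) c∈)))

    ∑ₚ-hits-≤ : ∀ (P : List (Cell n)) → UniqueL P → ∑ₚ (hits P) * (n P′ length P) ≤ #permutations n
    ∑ₚ-hits-≤ P u with compatible-or-unhit P u
    ... | inj₁ (u₁ , u₂) = ≤-reflexive (∑ₚ-hits-compatible P u₁ u₂)
    ... | inj₂ z rewrite ∑ₚ-0 {hits P} z = z≤n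

  module _ {n : ℕ} .{{_ : NonZero n}} where

    -- Addition of shifts modulo `n`

    toℕ-⊕ : ∀ (i j : Fin n) → toℕ (i ⊕ j) ≡ (toℕ i + toℕ j) % n
    toℕ-⊕ i j = Fin.toℕ-fromℕ< _

    %-+ : ∀ x y → (x % n + y) % n ≡ (x + y) % n
    %-+ x y = trans (%-distribˡ-+ (x % n) y n)
      (trans (cong (λ t → (t + y % n) % n) (m%n%n≡m%n x n)) (sym (%-distribˡ-+ x y n)))

    ⊕-comm : ∀ (i j : Fin n) → i ⊕ j ≡ j ⊕ i
    ⊕-comm i j = Fin.toℕ-injective (trans (toℕ-⊕ i j)
      (trans (cong (_% n) (+-comm (toℕ i) (toℕ j))) (sym (toℕ-⊕ j i))))

    ⊕-assoc : ∀ (i j k : Fin n) → (i ⊕ j) ⊕ k ≡ i ⊕ (j ⊕ k)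
    ⊕-assoc i j k = Fin.toℕ-injective (begin
      toℕ ((i ⊕ j) ⊕ k)                ≡⟨ toℕ-⊕ (i ⊕ j) k ⟩
      (toℕ (i ⊕ j) + toℕ k) % n        ≡⟨ cong (λ t → (t + toℕ k) % n) (toℕ-⊕ i j) ⟩
      ((toℕ i + toℕ j) % n + toℕ k) % n ≡⟨ %-+ (toℕ i + toℕ j) (toℕ k) ⟩
      (toℕ i + toℕ j + toℕ k) % n      ≡⟨ cong (_% n) (trans (+-assoc (toℕ i) _ _) (+-comm (toℕ i) _)) ⟩
      (toℕ j + toℕ k + toℕ i) % n      ≡⟨ %-+ (toℕ j + toℕ k) (toℕ i) ⟨
      ((toℕ j + toℕ k) % n + toℕ i) % n ≡⟨ cong (_% n) (+-comm _ (toℕ i)) ⟩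
      (toℕ i + (toℕ j + toℕ k) % n) % n ≡⟨ cong (λ t → (toℕ i + t) % n) (toℕ-⊕ j k) ⟨
      (toℕ i + toℕ (j ⊕ k)) % n        ≡⟨ toℕ-⊕ i (j ⊕ k) ⟨
      toℕ (i ⊕ (j ⊕ k))                ∎)
      where open ≡-Reasoning

    -- The reduction takes care of `h` = 0, where the difference is `n` itself.
    ⊖_ : Fin n → Fin n
    ⊖ h = (n ∸ toℕ h) mod n

    ⊕-⊖ : ∀ (i h : Fin n) → (i ⊕ h) ⊕ (⊖ h) ≡ i
    ⊕-⊖ i h = Fin.toℕ-injective (begin
      toℕ ((i ⊕ h) ⊕ (⊖ h))                  ≡⟨ toℕ-⊕ (i ⊕ h) (⊖ h) ⟩
      (toℕ (i ⊕ h) + toℕ (⊖ h)) % n          ≡⟨ cong₂ (λ s t → (s + t) % n) (toℕ-⊕ i h) (Fin.toℕ-fromℕ< _) ⟩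
      ((toℕ i + toℕ h) % n + (n ∸ toℕ h) % n) % n ≡⟨ %-distribˡ-+ (toℕ i + toℕ h) (n ∸ toℕ h) n ⟨
      (toℕ i + toℕ h + (n ∸ toℕ h)) % n      ≡⟨ cong (_% n) (trans (+-assoc (toℕ i) _ _)
                                                 (cong (toℕ i +_) (m+[n∸m]≡n (<⇒≤ (Fin.toℕ<n h))))) ⟩
      (toℕ i + n) % n                        ≡⟨ [m+n]%n≡m%n (toℕ i) n ⟩
      toℕ i % n                              ≡⟨ m<n⇒m%n≡m (Fin.toℕ<n i) ⟩
      toℕ i                                  ∎)
      where open ≡-Reasoning

    ⊖-⊕ : ∀ (i h : Fin n) → (i ⊕ (⊖ h)) ⊕ h ≡ i
    ⊖-⊕ i h = trans (⊕-assoc i (⊖ h) h)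
      (trans (cong (i ⊕_) (⊕-comm (⊖ h) h)) (trans (sym (⊕-assoc i h (⊖ h))) (⊕-⊖ i h)))

    ⊕-cancelʳ : ∀ {i j : Fin n} h → i ⊕ h ≡ j ⊕ h → i ≡ j
    ⊕-cancelʳ {i} {j} h eq = trans (sym (⊕-⊖ i h)) (trans (cong (_⊕ (⊖ h)) eq) (⊕-⊖ j h))

    ⊕-cancelˡ : ∀ {i j : Fin n} h → h ⊕ i ≡ h ⊕ j → i ≡ j
    ⊕-cancelˡ {i} {j} h eq = ⊕-cancelʳ h (trans (⊕-comm i h) (trans eq (⊕-comm h j)))

    -- Tuples of matches under prescribed shifts

    _∈ᶜ?_ = DecMembership._∈?_ (≡-dec (Fin._≟_ {n}) (Fin._≟_ {n}))
    _∉ᶜ?_ = DecMembership._∉?_ (≡-dec (Fin._≟_ {n}) (Fin._≟_ {n}))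
    open DecMembership (Fin._≟_ {n}) using (_∉?_)

    cell : Fin n → Fin n → Cell n
    cell h ℓ = ℓ ⊕ h , ℓ

    -- `tuples P (h₁ ∷ … ∷ hᵣ ∷ [])` counts the ℓ₁, …, ℓᵣ for which the cells of the ℓᵢ
    -- under the shifts hᵢ are obeyed by σ and distinct from each other and from P.
    tuples : List (Cell n) → List (Fin n) → Vec (Fin n) n → ℕ
    tuples P []      σ = hits P σ
    tuples P (h ∷ w) σ = ∑ᶠ (λ ℓ → ⟦ cell h ℓ ∉ᶜ? P ⟧ * tuples (cell h ℓ ∷ P) w σ)

    ∑ₚ-tuples-∷ : ∀ P h w → ∑ₚ (tuples P (h ∷ w)) ≡ ∑ᶠ (λ ℓ → ⟦ cell h ℓ ∉ᶜ? P ⟧ * ∑ₚ (tuples (cell h ℓ ∷ P) w))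
    ∑ₚ-tuples-∷ P h w = trans (∑-swap (permutations n) (List.allFin n) _)
      (∑-cong (List.allFin n) (λ ℓ → sym (*-∑ (permutations n) ⟦ cell h ℓ ∉ᶜ? P ⟧ _)))

    -- Every shift in `w` leaves at most `n` choices of ℓ, and each complete choice is a list of
    -- distinct cells, to which the bound for prescribed values applies. Skipping the cells already
    -- in `P` is what keeps the list distinct.
    ∑ₚ-tuples-≤ : ∀ P w → UniqueL P →
                  ∑ₚ (tuples P w) * (n P′ (length P + length w)) ≤ n ^ length w * #permutations n
    ∑ₚ-tuples-≤ P [] u rewrite +-identityʳ (length P) =
      ≤-trans (∑ₚ-hits-≤ P u) (≤-reflexive (sym (+-identityʳ _)))
    ∑ₚ-tuples-≤ P (h ∷ w) u rewrite ∑ₚ-tuples-∷ P h w | +-suc (length P) (length w) = begin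
      ∑ᶠ (λ ℓ → ⟦ cell h ℓ ∉ᶜ? P ⟧ * ∑ₚ (tuples (cell h ℓ ∷ P) w)) * F
        ≡⟨ ∑-* (List.allFin n) F _ ⟩
      ∑ᶠ (λ ℓ → ⟦ cell h ℓ ∉ᶜ? P ⟧ * ∑ₚ (tuples (cell h ℓ ∷ P) w) * F)
        ≤⟨ ∑-mono (List.allFin n) bound ⟩
      ∑ᶠ {n} (λ ℓ → n ^ length w * #permutations n)
        ≡⟨ ∑ᶠ-const n _ ⟩
      n * (n ^ length w * #permutations n)
        ≡⟨ *-assoc n (n ^ length w) _ ⟨
      n * n ^ length w * #permutations n ∎
      where
      open ≤-Reasoning
      F = n P′ suc (length P + length w)
      bound : ∀ ℓ → ⟦ cell h ℓ ∉ᶜ? P ⟧ * ∑ₚ (tuples (cell h ℓ ∷ P) w) * F ≤ n ^ length w * #permutations n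
      bound ℓ with cell h ℓ ∈ᶜ? P
      ... | yes _ = z≤n
      ... | no c∉ rewrite +-identityʳ (∑ₚ (tuples (cell h ℓ ∷ P) w)) =
        ∑ₚ-tuples-≤ (cell h ℓ ∷ P) w (¬Any⇒All¬ P c∉ AP.∷ u)

    -- Cells of one shift with different ℓ differ in position and in value, so they are always
    -- compatible. There are `n ∸ length L` ways to add one, and each is obeyed by that same
    -- fraction of the permutations obeying the earlier cells: the two factors cancel. The bound on
    -- `length L + k` keeps the factor positive.
    ∑ₚ-tuples-shift : ∀ h k L → UniqueL L → length L + k ≤ n →
                      ∑ₚ (tuples (map (cell h) L) (replicate k h)) ≡ ∑ₚ (hits (map (cell h) L))
    ∑ₚ-tuples-shift h zero    L u le = refl
    ∑ₚ-tuples-shift h (suc k) L u le = trans (∑ₚ-tuples-∷ P h (replicate k h))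
      (*-cancelˡ-≡ _ _ d {{>-nonZero d>0}} (begin
        d * ∑ᶠ (λ ℓ → ⟦ cell h ℓ ∉ᶜ? P ⟧ * ∑ₚ (tuples (cell h ℓ ∷ P) (replicate k h)))
          ≡⟨ *-∑ (List.allFin n) d _ ⟩
        ∑ᶠ (λ ℓ → d * (⟦ cell h ℓ ∉ᶜ? P ⟧ * ∑ₚ (tuples (cell h ℓ ∷ P) (replicate k h))))
          ≡⟨ ∑-cong (List.allFin n) each ⟩
        ∑ᶠ (λ ℓ → ⟦ ℓ ∉? L ⟧ * ∑ₚ (hits P))
          ≡⟨ ∑-* (List.allFin n) (∑ₚ (hits P)) _ ⟨
        ∑ᶠ (λ ℓ → ⟦ ℓ ∉? L ⟧) * ∑ₚ (hits P)
          ≡⟨ cong (_* ∑ₚ (hits P)) (trans (sym (m+n∸n≡m _ (length L))) (cong (_∸ length L) (∑-∉ L u))) ⟩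
        d * ∑ₚ (hits P) ∎))
      where
      open ≡-Reasoning
      P = map (cell h) L
      d = n ∸ length L
      d>0 : 0 < d
      d>0 = m<n⇒0<n∸m (≤-trans (s≤s (m≤m+n _ k)) (≤-trans (≤-reflexive (sym (+-suc _ k))) le))
      values : ∀ L → map proj₂ (map (cell h) L) ≡ L
      values []      = refl
      values (ℓ ∷ L) = cong (ℓ ∷_) (values L)
      positions : ∀ {ℓ} L → ℓ ⊕ h ∈ map proj₁ (map (cell h) L) → ℓ ∈ L
      positions (ℓ ∷ L) (here eq) = here (⊕-cancelʳ h eq)
      positions (ℓ ∷ L) (there i) = there (positions L i)
      each : ∀ ℓ → d * (⟦ cell h ℓ ∉ᶜ? P ⟧ * ∑ₚ (tuples (cell h ℓ ∷ P) (replicate k h)))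
                 ≡ ⟦ ℓ ∉? L ⟧ * ∑ₚ (hits P)
      each ℓ with cell h ℓ ∈ᶜ? P
      ... | yes c∈ = trans (*-zeroʳ d) (cong (_* ∑ₚ (hits P)) (sym (⟦⟧-no (ℓ ∉? L) (λ ℓ∉ →
        ℓ∉ (positions L (∈-map⁺ proj₁ c∈))))))
      ... | no c∉ rewrite ⟦⟧-yes (ℓ ∉? L) (λ ℓ∈ → c∉ (∈-map⁺ (cell h) ℓ∈)) = begin
        d * (1 * ∑ₚ (tuples (cell h ℓ ∷ P) (replicate k h)))
          ≡⟨ cong (d *_) (trans (+-identityʳ _) (∑ₚ-tuples-shift h k (ℓ ∷ L)
               (¬Any⇒All¬ L (λ ℓ∈ → c∉ (∈-map⁺ (cell h) ℓ∈)) AP.∷ u)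
               (≤-trans (≤-reflexive (sym (+-suc _ k))) le))) ⟩
        d * ∑ₚ (hits (cell h ℓ ∷ P))
          ≡⟨ cong (λ t → (n ∸ t) * ∑ₚ (hits (cell h ℓ ∷ P))) (length-map (cell h) L) ⟨
        (n ∸ length P) * ∑ₚ (hits (cell h ℓ ∷ P))
          ≡⟨ ∑ₚ-hits-∷ P (subst UniqueL (sym (values L)) u)
               (λ i → c∉ (∈-map⁺ (cell h) (positions L i)))
               (λ i → c∉ (∈-map⁺ (cell h) (subst (ℓ ∈_) (values L) i))) ⟩
        ∑ₚ (hits P)
          ≡⟨ +-identityʳ _ ⟨
        1 * ∑ₚ (hits P) ∎

    matches : Fin n → Vec (Fin n) n → ℕ
    matches h σ = ∑ᶠ (λ ℓ → at (cell h ℓ) σ)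

    onShift : Fin n → List (Cell n) → ℕ
    onShift h P = ∑ᶠ (λ ℓ → ⟦ cell h ℓ ∈ᶜ? P ⟧)

    onShift-same : ∀ h ℓ P → cell h ℓ ∉ P → onShift h (cell h ℓ ∷ P) ≡ suc (onShift h P)
    onShift-same h ℓ P c∉ = trans (∑-cong (List.allFin n) split)
      (trans (∑-+ (List.allFin n) _ _) (cong (_+ onShift h P) (∑ᶠ-⟦≡⟧ ℓ)))
      where
      split : ∀ m → ⟦ cell h m ∈ᶜ? (cell h ℓ ∷ P) ⟧ ≡ ⟦ ℓ Fin.≟ m ⟧ + ⟦ cell h m ∈ᶜ? P ⟧
      split m with ℓ Fin.≟ m
      ... | yes refl = trans (⟦⟧-yes (cell h ℓ ∈ᶜ? (cell h ℓ ∷ P)) (here refl))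
                             (cong suc (sym (⟦⟧-no (cell h ℓ ∈ᶜ? P) c∉)))
      ... | no ℓ≢m = ⟦⟧-cong (cell h m ∈ᶜ? (cell h ℓ ∷ P)) (cell h m ∈ᶜ? P)
                       (λ { (here eq) → contradiction (sym (cong proj₂ eq)) ℓ≢m ; (there i) → i }) there

    onShift-other : ∀ {h h′} → h ≢ h′ → ∀ ℓ P → onShift h′ (cell h ℓ ∷ P) ≡ onShift h′ P
    onShift-other {h} {h′} h≢h′ ℓ P = ∑-cong (List.allFin n) (λ m →
      ⟦⟧-cong (cell h′ m ∈ᶜ? (cell h ℓ ∷ P)) (cell h′ m ∈ᶜ? P)
        (λ { (here eq) → contradiction (sym (⊕-cancelˡ ℓ (subst (λ t → t ⊕ h′ ≡ ℓ ⊕ h) (cong proj₂ eq) (cong proj₁ eq)))) h≢h′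
           ; (there i) → i }) there)

    at-hits : ∀ {c : Cell n} P σ → c ∈ P → at c σ * hits P σ ≡ hits P σ
    at-hits {a , b} (_ ∷ P) σ (here refl) with lookup σ a Fin.≟ b
    ... | yes _ = +-identityʳ _
    ... | no _  = refl
    at-hits {c} (c′ ∷ P) σ (there i) = trans
      (solve 3 (λ x y z → x :* (y :* z) := y :* (x :* z)) refl (at c σ) (at c′ σ) (hits P σ))
      (cong (at c′ σ *_) (at-hits P σ i))

    -- If σ obeys `P`, the cells of `P` on shift `h` are themselves matches and just have to be
    -- discounted, so the subtraction does not truncate. If σ does not obey `P`, both sides vanish.
    hits-extend : ∀ h P σ → ∑ᶠ (λ ℓ → ⟦ cell h ℓ ∉ᶜ? P ⟧ * hits (cell h ℓ ∷ P) σ)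
                          ≡ hits P σ * (matches h σ ∸ onShift h P)
    hits-extend h P σ = begin
      new
        ≡⟨ m+n∸n≡m new (onShift h P * hits P σ) ⟨
      new + onShift h P * hits P σ ∸ onShift h P * hits P σ
        ≡⟨ cong (_∸ onShift h P * hits P σ) (begin
          new + onShift h P * hits P σ
            ≡⟨ cong (new +_) (∑-* (List.allFin n) (hits P σ) _) ⟩
          new + ∑ᶠ (λ ℓ → ⟦ cell h ℓ ∈ᶜ? P ⟧ * hits P σ)
            ≡⟨ ∑-+ (List.allFin n) _ _ ⟨
          ∑ᶠ (λ ℓ → ⟦ cell h ℓ ∉ᶜ? P ⟧ * hits (cell h ℓ ∷ P) σ + ⟦ cell h ℓ ∈ᶜ? P ⟧ * hits P σ)
            ≡⟨ ∑-cong (List.allFin n) split ⟩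
          ∑ᶠ (λ ℓ → at (cell h ℓ) σ * hits P σ)
            ≡⟨ ∑-* (List.allFin n) (hits P σ) _ ⟨
          matches h σ * hits P σ ∎) ⟩
      matches h σ * hits P σ ∸ onShift h P * hits P σ
        ≡⟨ *-distribʳ-∸ (hits P σ) (matches h σ) (onShift h P) ⟨
      (matches h σ ∸ onShift h P) * hits P σ
        ≡⟨ *-comm _ (hits P σ) ⟩
      hits P σ * (matches h σ ∸ onShift h P) ∎
      where
      open ≡-Reasoning
      new = ∑ᶠ (λ ℓ → ⟦ cell h ℓ ∉ᶜ? P ⟧ * hits (cell h ℓ ∷ P) σ)
      split : ∀ ℓ → ⟦ cell h ℓ ∉ᶜ? P ⟧ * hits (cell h ℓ ∷ P) σ + ⟦ cell h ℓ ∈ᶜ? P ⟧ * hits P σ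
                  ≡ at (cell h ℓ) σ * hits P σ
      split ℓ with cell h ℓ ∈ᶜ? P
      ... | yes i = trans (+-identityʳ _) (sym (at-hits P σ i))
      ... | no _  = trans (+-identityʳ _) (+-identityʳ _)

    -- Here `g` is the number of ways to complete the tuple. It may be pulled out of the sum because
    -- it is the same for every fresh ℓ.
    tuples-∷ : ∀ h P w σ g → (∀ ℓ → cell h ℓ ∉ P → tuples (cell h ℓ ∷ P) w σ ≡ hits (cell h ℓ ∷ P) σ * g) →
               tuples P (h ∷ w) σ ≡ hits P σ * (matches h σ ∸ onShift h P) * g
    tuples-∷ h P w σ g rest = trans (∑-cong (List.allFin n) each)
      (trans (sym (∑-* (List.allFin n) g _)) (cong (_* g) (hits-extend h P σ)))
      where
      each : ∀ ℓ → ⟦ cell h ℓ ∉ᶜ? P ⟧ * tuples (cell h ℓ ∷ P) w σ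
                 ≡ ⟦ cell h ℓ ∉ᶜ? P ⟧ * hits (cell h ℓ ∷ P) σ * g
      each ℓ with cell h ℓ ∈ᶜ? P
      ... | yes _ = refl
      ... | no c∉ = trans (cong (1 *_) (rest ℓ c∉)) (sym (*-assoc 1 (hits (cell h ℓ ∷ P) σ) g))

    -- The definition of `_P′_` splits off the smallest factor, whereas choosing the first match of
    -- a tuple splits off the largest.
    P′-suc : ∀ c k → c P′ suc k ≡ c * ((c ∸ 1) P′ k)
    P′-suc zero    k = cong (_* (0 P′ k)) (0∸n≡0 k)
    P′-suc (suc c) k = nP′k≡n[n∸1P′k∸1] (suc c) (suc k)

    ∸-P′-suc : ∀ c m k → (c ∸ m) P′ suc k ≡ (c ∸ m) * ((c ∸ suc m) P′ k)
    ∸-P′-suc c m k = trans (P′-suc (c ∸ m) k) (cong (λ t → (c ∸ m) * (t P′ k))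
      (trans (∸-+-assoc c m 1) (cong (c ∸_) (+-comm m 1))))

    tuples-one : ∀ h k P σ → tuples P (replicate k h) σ ≡ hits P σ * ((matches h σ ∸ onShift h P) P′ k)
    tuples-one h zero    P σ = sym (*-identityʳ _)
    tuples-one h (suc k) P σ = trans
      (tuples-∷ h P (replicate k h) σ ((matches h σ ∸ suc (onShift h P)) P′ k) (λ ℓ c∉ →
        trans (tuples-one h k (cell h ℓ ∷ P) σ)
          (cong (λ t → hits (cell h ℓ ∷ P) σ * ((matches h σ ∸ t) P′ k)) (onShift-same h ℓ P c∉))))
      (trans (*-assoc (hits P σ) _ _) (cong (hits P σ *_) (sym (∸-P′-suc (matches h σ) (onShift h P) k))))

    -- A cell determines its shift as the difference of its coordinates. Matches chosen under `h`
    -- thus leave the supply under `h′` untouched, and for a fixed σ the count factors.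
    tuples-two : ∀ {h h′} → h ≢ h′ → ∀ k k′ P σ → tuples P (replicate k h ++ replicate k′ h′) σ
      ≡ hits P σ * (((matches h σ ∸ onShift h P) P′ k) * ((matches h′ σ ∸ onShift h′ P) P′ k′))
    tuples-two {h} {h′} h≢h′ zero    k′ P σ = trans (tuples-one h′ k′ P σ) (cong (hits P σ *_) (sym (+-identityʳ _)))
    tuples-two {h} {h′} h≢h′ (suc k) k′ P σ = trans
      (tuples-∷ h P (replicate k h ++ replicate k′ h′) σ (((matches h σ ∸ suc (onShift h P)) P′ k) * G) (λ ℓ c∉ →
        trans (tuples-two h≢h′ k k′ (cell h ℓ ∷ P) σ)
          (cong₂ (λ s t → hits (cell h ℓ ∷ P) σ * (((matches h σ ∸ s) P′ k) * ((matches h′ σ ∸ t) P′ k′)))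
            (onShift-same h ℓ P c∉) (onShift-other h≢h′ ℓ P))))
      (trans (solve 4 (λ a b c d → a :* b :* (c :* d) := a :* (b :* c :* d)) refl
               (hits P σ) (matches h σ ∸ onShift h P) ((matches h σ ∸ suc (onShift h P)) P′ k) G)
        (cong (λ t → hits P σ * (t * G)) (sym (∸-P′-suc (matches h σ) (onShift h P) k))))
      where G = (matches h′ σ ∸ onShift h′ P) P′ k′

    onShift-[] : ∀ h → onShift h [] ≡ 0
    onShift-[] h = trans (∑ᶠ-const n 0) (*-zeroʳ n)

    -- For a fixed shift, `matches` counts the fixed points of a rotated uniform permutation. Its
    -- factorial moments up to order `n` are those of a Poisson variable of mean 1.
    ∑ₚ-P′ : ∀ h k → k ≤ n → ∑ₚ (λ σ → matches h σ P′ k) ≡ #permutations n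
    ∑ₚ-P′ h k k≤n = begin
      ∑ₚ (λ σ → matches h σ P′ k)        ≡⟨ ∑-cong (permutations n) (λ σ → sym (trans (tuples-one h k [] σ)
                                              (trans (+-identityʳ _) (cong (λ t → (matches h σ ∸ t) P′ k) (onShift-[] h))))) ⟩
      ∑ₚ (tuples [] (replicate k h))     ≡⟨ ∑ₚ-tuples-shift h k [] AP.[] k≤n ⟩
      ∑ₚ {n} (hits [])                   ≡⟨ ∑ₚ-1 {n} ⟩
      #permutations n                      ∎
      where open ≡-Reasoning

    ∑ₚ-P′-distinct : ∀ {h h′} → h ≢ h′ → ∀ k → ∑ₚ (λ σ → (matches h σ P′ k) * (matches h′ σ P′ k)) * (n P′ (k + k))
                     ≤ n ^ (k + k) * #permutations n
    ∑ₚ-P′-distinct {h} {h′} h≢h′ k = begin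
      ∑ₚ (λ σ → (matches h σ P′ k) * (matches h′ σ P′ k)) * (n P′ (k + k))
        ≡⟨ cong₂ (λ s t → s * (n P′ t)) (∑-cong (permutations n) (λ σ → sym (trans (tuples-two h≢h′ k k [] σ)
             (trans (+-identityʳ _) (cong₂ (λ s t → ((matches h σ ∸ s) P′ k) * ((matches h′ σ ∸ t) P′ k))
               (onShift-[] h) (onShift-[] h′)))))) (sym len) ⟩
      ∑ₚ (tuples [] w) * (n P′ length w)
        ≤⟨ ∑ₚ-tuples-≤ [] w AP.[] ⟩
      n ^ length w * #permutations n
        ≡⟨ cong (λ t → n ^ t * #permutations n) len ⟩
      n ^ (k + k) * #permutations n ∎
      where
      open ≤-Reasoning
      w = replicate k h ++ replicate k h′
      len : length w ≡ k + k
      len = trans (length-++ (replicate k h)) (cong₂ _+_ (length-replicate k) (length-replicate k))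

  -- The second moment method

  P′≡0 : ∀ {c k} → c < k → c P′ k ≡ 0
  P′≡0 {c} {suc k} (s≤s c≤k) rewrite m≤n⇒m∸n≡0 c≤k = refl

  P′≤^ : ∀ n k → n P′ k ≤ n ^ k
  P′≤^ n zero    = ≤-refl
  P′≤^ n (suc k) = *-mono-≤ (m∸n≤m n k) (P′≤^ n k)

  -- n P′ j ≥ nʲ (1 − j² / n), in a form without subtraction or division.
  ^≤P′ : ∀ n j → n ^ suc j ≤ (n P′ j) * n + j * j * n ^ j
  ^≤P′ n zero    = ≤-reflexive (solve 1 (λ n → n :* con 1 := con 1 :* n :+ con 0) refl n)
  ^≤P′ n (suc j) = begin
    n * n ^ suc j
      ≤⟨ *-monoʳ-≤ n (^≤P′ n j) ⟩
    n * (p * n + j * j * n ^ j)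
      ≤⟨ *-monoʳ-≤ n (+-monoˡ-≤ _ (*-monoʳ-≤ p (m≤n+m∸n n j))) ⟩
    n * (p * (j + (n ∸ j)) + j * j * n ^ j)
      ≡⟨ solve 5 (λ n p j d q → n :* (p :* (j :+ d) :+ j :* j :* q) := d :* p :* n :+ (j :* n :* p :+ j :* j :* (n :* q)))
           refl n p j (n ∸ j) (n ^ j) ⟩
    (n ∸ j) * p * n + (j * n * p + j * j * (n * n ^ j))
      ≤⟨ +-monoʳ-≤ ((n ∸ j) * p * n) (+-monoˡ-≤ _ (*-monoʳ-≤ (j * n) (P′≤^ n j))) ⟩
    (n ∸ j) * p * n + (j * n * n ^ j + j * j * (n * n ^ j))
      ≤⟨ +-monoʳ-≤ ((n ∸ j) * p * n) (m≤m+n _ (suc j * (n * n ^ j))) ⟩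
    (n ∸ j) * p * n + (j * n * n ^ j + j * j * (n * n ^ j) + suc j * (n * n ^ j))
      ≡⟨ cong ((n ∸ j) * p * n +_) (solve 3 (λ j n q → j :* n :* q :+ j :* j :* (n :* q) :+ (con 1 :+ j) :* (n :* q)
           := (con 1 :+ j) :* (con 1 :+ j) :* (n :* q)) refl j n (n ^ j)) ⟩
    (n ∸ j) * p * n + suc j * suc j * (n * n ^ j) ∎
    where
    open ≤-Reasoning
    p = n P′ j

  2xy≤x²+y² : ∀ x y → 2 * (x * y) ≤ x * x + y * y
  2xy≤x²+y² x y with ≤-total x y
  ... | inj₁ x≤y with m≤n⇒∃[o]m+o≡n x≤y
  ...   | d , refl = ≤-trans (m≤m+n _ (d * d)) (≤-reflexive
          (solve 2 (λ x d → con 2 :* (x :* (x :+ d)) :+ d :* d := x :* x :+ (x :+ d) :* (x :+ d)) refl x d))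
  2xy≤x²+y² x y | inj₂ y≤x with m≤n⇒∃[o]m+o≡n y≤x
  ...   | d , refl = ≤-trans (m≤m+n _ (d * d)) (≤-reflexive
          (solve 2 (λ x d → con 2 :* ((x :+ d) :* x) :+ d :* d := (x :+ d) :* (x :+ d) :+ x :* x) refl y d))

  module _ {n : ℕ} .{{_ : NonZero n}} where

    -- This controls the diagonal terms of E X². Moving one factor from the second falling factorial
    -- to the first uses C ∸ b ≤ C ≤ a + (C ∸ a). The part C ∸ a lengthens the first factorial by
    -- one and the part a is a constant, so each of the b moves costs a factor of at most 1 + a + b.
    -- What is left in the end is a single factorial moment, which is exactly 1; `a + b ≤ n` keeps
    -- its order in range.
    ∑ₚ-P′-same : ∀ h a b → a + b ≤ n →
                 ∑ₚ (λ σ → (matches h σ P′ a) * (matches h σ P′ b)) ≤ suc (a + b) ^ b * #permutations n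
    ∑ₚ-P′-same h a zero a+b≤n = ≤-reflexive (trans
      (∑-cong (permutations n) (λ σ → *-identityʳ (matches h σ P′ a)))
      (trans (∑ₚ-P′ h a (≤-trans (m≤m+n a 0) a+b≤n)) (sym (+-identityʳ _))))
    ∑ₚ-P′-same h a (suc b) a+b≤n = begin
      ∑ₚ (λ σ → p a σ * ((C σ ∸ b) * p b σ))
        ≤⟨ ∑-mono (permutations n) (λ σ → begin
          p a σ * ((C σ ∸ b) * p b σ)
            ≤⟨ *-monoʳ-≤ (p a σ) (*-monoˡ-≤ (p b σ) (≤-trans (m∸n≤m (C σ) b) (m≤n+m∸n (C σ) a))) ⟩
          p a σ * ((a + (C σ ∸ a)) * p b σ)
            ≡⟨ solve 4 (λ x a d y → x :* ((a :+ d) :* y) := d :* x :* y :+ a :* (x :* y))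
                refl (p a σ) a (C σ ∸ a) (p b σ) ⟩
          p (suc a) σ * p b σ + a * (p a σ * p b σ) ∎) ⟩
      ∑ₚ (λ σ → p (suc a) σ * p b σ + a * (p a σ * p b σ))
        ≡⟨ trans (∑-+ (permutations n) _ _) (cong (∑ₚ (λ σ → p (suc a) σ * p b σ) +_)
            (sym (*-∑ (permutations n) a _))) ⟩
      ∑ₚ (λ σ → p (suc a) σ * p b σ) + a * ∑ₚ (λ σ → p a σ * p b σ)
        ≤⟨ +-mono-≤ (∑ₚ-P′-same h (suc a) b (≤-trans (≤-reflexive (sym (+-suc a b))) a+b≤n))
             (*-monoʳ-≤ a (≤-trans (∑ₚ-P′-same h a b (≤-trans (+-monoʳ-≤ a (n≤1+n b)) a+b≤n))
               (*-monoˡ-≤ N (^-monoˡ-≤ b (n≤1+n (suc (a + b))))))) ⟩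
      K ^ b * N + a * (K ^ b * N)
        ≡⟨ solve 3 (λ a x y → x :* y :+ a :* (x :* y) := (con 1 :+ a) :* x :* y) refl a (K ^ b) N ⟩
      suc a * K ^ b * N
        ≤⟨ *-monoˡ-≤ N (*-monoˡ-≤ (K ^ b) (s≤s (≤-trans (m≤m+n a b) (n≤1+n _)))) ⟩
      K * K ^ b * N
        ≡⟨ cong (λ t → suc t ^ suc b * N) (sym (+-suc a b)) ⟩
      suc (a + suc b) ^ suc b * N ∎
      where
      open ≤-Reasoning
      N = #permutations n
      K = suc (suc (a + b))
      C = matches {n} h
      p : ℕ → Vec (Fin n) n → ℕ
      p k σ = C σ P′ k

    module _ (k : ℕ) where

      -- The number of ordered k-tuples of matches, over all shifts.
      X : Vec (Fin n) n → ℕ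
      X σ = ∑ᶠ (λ h → matches h σ P′ k)

      ∑ₚ-X : k ≤ n → ∑ₚ X ≡ n * #permutations n
      ∑ₚ-X k≤n = trans (∑-swap (permutations n) (List.allFin n) _)
        (trans (∑-cong (List.allFin n) (λ h → ∑ₚ-P′ h k k≤n)) (∑ᶠ-const n _))

      -- The estimate for distinct shifts is charged to all n² pairs, the diagonal included, and the
      -- `n` diagonal pairs pay their own bound on top.
      ∑ₚ-X² : k + k ≤ n → ∑ₚ (λ σ → X σ * X σ) * (n P′ (k + k))
              ≤ n * (suc (k + k) ^ k * #permutations n * (n P′ (k + k)) + n * (n ^ (k + k) * #permutations n))
      ∑ₚ-X² 2k≤n = begin
        ∑ₚ (λ σ → X σ * X σ) * F
          ≡⟨ cong (_* F) (trans (∑-cong (permutations n) (λ σ → trans (∑-* (List.allFin n) (X σ) _)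
               (∑-cong (List.allFin n) (λ h → *-∑ (List.allFin n) (matches h σ P′ k) _))))
               (trans (∑-swap (permutations n) (List.allFin n) _)
                 (∑-cong (List.allFin n) (λ h → ∑-swap (permutations n) (List.allFin n) _)))) ⟩
        ∑ᶠ (λ h → ∑ᶠ (λ h′ → pair h h′)) * F
          ≡⟨ trans (∑-* (List.allFin n) F _) (∑-cong (List.allFin n) (λ h → ∑-* (List.allFin n) F _)) ⟩
        ∑ᶠ (λ h → ∑ᶠ (λ h′ → pair h h′ * F))
          ≤⟨ ∑-mono (List.allFin n) (λ h → ∑-mono (List.allFin n) (bound h)) ⟩
        ∑ᶠ {n} (λ h → ∑ᶠ (λ h′ → ⟦ h Fin.≟ h′ ⟧ * (E * N * F) + n ^ (k + k) * N))
          ≡⟨ trans (∑-cong (List.allFin n) (λ h → trans (∑-+ (List.allFin n) _ _) (cong₂ _+_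
               (trans (sym (∑-* (List.allFin n) (E * N * F) _)) (trans (cong (_* (E * N * F)) (∑ᶠ-⟦≡⟧ h)) (+-identityʳ _)))
               (∑ᶠ-const n _))))
               (∑ᶠ-const n _) ⟩
        n * (E * N * F + n * (n ^ (k + k) * N)) ∎
        where
        open ≤-Reasoning
        N = #permutations n
        F = n P′ (k + k)
        E = suc (k + k) ^ k
        pair : Fin n → Fin n → ℕ
        pair h h′ = ∑ₚ (λ σ → (matches h σ P′ k) * (matches h′ σ P′ k))
        bound : ∀ h h′ → pair h h′ * F ≤ ⟦ h Fin.≟ h′ ⟧ * (E * N * F) + n ^ (k + k) * N
        bound h h′ with h Fin.≟ h′
        ... | no h≢h′  = ∑ₚ-P′-distinct h≢h′ k
        ... | yes refl = ≤-trans (*-monoˡ-≤ F (∑ₚ-P′-same h k k 2k≤n))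
                           (≤-trans (m≤m+n _ 0) (m≤m+n _ (n ^ (k + k) * N)))

      -- 1[X>0] ≥ 2X/n − (X/n)², and X > 0 forces a shift with at least k matches.
      maximum-bound : ∀ M σ → (∀ h → matches h σ ≤ M) → 2 * k * n * X σ ≤ n * n * M + k * (X σ * X σ)
      maximum-bound M σ ≤M with k ≤? M
      ... | yes k≤M = begin
        2 * k * n * X σ               ≡⟨ solve 3 (λ k n x → con 2 :* k :* n :* x := k :* (con 2 :* (n :* x)))
            refl k n (X σ) ⟩
        k * (2 * (n * X σ))           ≤⟨ *-monoʳ-≤ k (2xy≤x²+y² n (X σ)) ⟩
        k * (n * n + X σ * X σ)       ≡⟨ solve 3 (λ k n x → k :* (n :* n :+ x :* x) := n :* n :* k :+ k :* (x :* x))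
            refl k n (X σ) ⟩
        n * n * k + k * (X σ * X σ)   ≤⟨ +-monoˡ-≤ _ (*-monoʳ-≤ (n * n) k≤M) ⟩
        n * n * M + k * (X σ * X σ)   ∎
        where open ≤-Reasoning
      ... | no k≰M = ≤-trans (≤-reflexive (trans (cong (2 * k * n *_) X≡0) (*-zeroʳ (2 * k * n)))) z≤n
        where
        X≡0 : X σ ≡ 0
        X≡0 = trans (∑-cong (List.allFin n) (λ h → P′≡0 (≤-<-trans (≤M h) (≰⇒> k≰M))))
          (trans (∑ᶠ-const n 0) (*-zeroʳ n))

      -- Averaging `maximum-bound`, with E X = n, leaves 2k ≤ E M + k E X² / n². With j = 2k and E =
      -- (j+1)^k, the diagonal adds kE/n ≤ 1/2 to the last term, and the other pairs add k n^j / (n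
      -- P′ j) ≤ k (1 + 1/j) = k + 1/2. Hence E M ≥ k - 1. The chain carries the common factor 2 n²
      -- F, under which both halves become integral.
      ∑ₚ-maximum : 1 ≤ k → (k + k) * (k + k) * suc (k + k) ≤ n → (k + k) * suc (k + k) ^ k ≤ n →
                   (M : Vec (Fin n) n → ℕ) → (∀ {σ} → Unique σ → ∀ h → matches h σ ≤ M σ) →
                   k * #permutations n ≤ ∑ₚ M + #permutations n
      ∑ₚ-maximum 1≤k j²[j+1]≤n jE≤n M ≤M = +-cancelʳ-≤ (k * N) _ _ (*-cancelˡ-≤ (n * n * F) {{n²F≢0}} (*-cancelˡ-≤ 2 (begin
        2 * (n * n * F * (k * N + k * N))
          ≡⟨ solve 4 (λ n F k N → con 2 :* (n :* n :* F :* (k :* N :+ k :* N))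
              := con 2 :* (con 2 :* k :* n :* (n :* N) :* F)) refl n F k N ⟩
        2 * (2 * k * n * (n * N) * F)
          ≡⟨ cong (λ t → 2 * (2 * k * n * t * F)) (sym (∑ₚ-X k≤n)) ⟩
        2 * (2 * k * n * ∑ₚ X * F)
          ≤⟨ *-monoʳ-≤ 2 (*-monoˡ-≤ F summed) ⟩
        2 * ((n * n * ∑ₚ M + k * ∑ₚ (λ σ → X σ * X σ)) * F)
          ≡⟨ solve 5 (λ n m k x F → con 2 :* ((n :* n :* m :+ k :* x) :* F)
               := con 2 :* (n :* n :* m :* F) :+ con 2 :* k :* (x :* F)) refl n (∑ₚ M) k (∑ₚ (λ σ → X σ * X σ)) F ⟩
        2 * (n * n * ∑ₚ M * F) + 2 * k * (∑ₚ (λ σ → X σ * X σ) * F)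
          ≤⟨ +-monoʳ-≤ _ (*-monoʳ-≤ (2 * k) (∑ₚ-X² 2k≤n)) ⟩
        2 * (n * n * ∑ₚ M * F) + 2 * k * (n * (E * N * F + n * (n ^ j * N)))
          ≡⟨ cong (2 * (n * n * ∑ₚ M * F) +_) (solve 6 (λ k n E N F q →
               con 2 :* k :* (n :* (E :* N :* F :+ n :* (q :* N)))
               := n :* N :* ((k :+ k) :* E :* F) :+ n :* n :* N :* ((k :+ k) :* q)) refl k n E N F (n ^ j)) ⟩
        2 * (n * n * ∑ₚ M * F) + (n * N * (j * E * F) + n * n * N * (j * n ^ j))
          ≤⟨ +-monoʳ-≤ (2 * (n * n * ∑ₚ M * F))
              (+-mono-≤ (*-monoʳ-≤ (n * N) (*-monoˡ-≤ F jE≤n)) (*-monoʳ-≤ (n * n * N) jn^j≤)) ⟩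
        2 * (n * n * ∑ₚ M * F) + (n * N * (n * F) + n * n * N * (suc j * F))
          ≡⟨ solve 5 (λ n m F N k → con 2 :* (n :* n :* m :* F) :+ (n :* N :* (n :* F)
              :+ n :* n :* N :* ((con 1 :+ (k :+ k)) :* F))
               := con 2 :* (n :* n :* F :* (m :+ N :+ k :* N))) refl n (∑ₚ M) F N k ⟩
        2 * (n * n * F * (∑ₚ M + N + k * N)) ∎)))
        where
        open ≤-Reasoning
        j = k + k
        N = #permutations n
        F = n P′ j
        E = suc j ^ k
        1≤j : 1 ≤ j
        1≤j = ≤-trans 1≤k (m≤m+n k k)
        2k≤n : j ≤ n
        2k≤n = ≤-trans (m≤m*n j (j * suc j) {{m*n≢0 j (suc j) {{>-nonZero 1≤j}}}})
          (≤-trans (≤-reflexive (sym (*-assoc j j (suc j)))) j²[j+1]≤n)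
        k≤n : k ≤ n
        k≤n = ≤-trans (m≤m+n k k) 2k≤n
        -- This is n^j / F ≤ 1 + 1/j. Multiplying the general bound by j + 1 gives the error term j²
        -- (j+1) n^j, and by hypothesis that is at most the spare copy of n · n^j added on the left.
        jn^j≤ : j * n ^ j ≤ suc j * F
        jn^j≤ = *-cancelˡ-≤ n (+-cancelʳ-≤ (n * n ^ j) _ _ (begin
          n * (j * n ^ j) + n * n ^ j
            ≡⟨ solve 3 (λ n j q → n :* (j :* q) :+ n :* q := (con 1 :+ j) :* (n :* q)) refl n j (n ^ j) ⟩
          suc j * n ^ suc j
            ≤⟨ *-monoʳ-≤ (suc j) (^≤P′ n j) ⟩
          suc j * (F * n + j * j * n ^ j)
            ≡⟨ solve 4 (λ n j F q → (con 1 :+ j) :* (F :* n :+ j :* j :* q)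
                 := n :* ((con 1 :+ j) :* F) :+ j :* j :* (con 1 :+ j) :* q) refl n j F (n ^ j) ⟩
          n * (suc j * F) + j * j * suc j * n ^ j
            ≤⟨ +-monoʳ-≤ _ (*-monoˡ-≤ (n ^ j) j²[j+1]≤n) ⟩
          n * (suc j * F) + n * n ^ j ∎))
        F≢0 : NonZero F
        F≢0 with F in eq
        ... | suc _ = _
        ... | zero  = contradiction (subst (λ t → j * n ^ j ≤ suc j * t) eq jn^j≤)
          (<⇒≱ (subst (_< j * n ^ j) (sym (*-zeroʳ (suc j))) (*-mono-≤ 1≤j (m^n>0 n j))))
        n²F≢0 : NonZero (n * n * F)
        n²F≢0 = m*n≢0 (n * n) F {{m*n≢0 n n}} {{F≢0}}
        summed : 2 * k * n * ∑ₚ X ≤ n * n * ∑ₚ M + k * ∑ₚ (λ σ → X σ * X σ)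
        summed = begin
          2 * k * n * ∑ₚ X
            ≡⟨ *-∑ (permutations n) (2 * k * n) X ⟩
          ∑ₚ (λ σ → 2 * k * n * X σ)
            ≤⟨ ∑-mono-∈ (permutations n) (λ {σ} σ∈ → maximum-bound (M σ) σ (≤M (∈-permutations⁻ σ∈))) ⟩
          ∑ₚ (λ σ → n * n * M σ + k * (X σ * X σ))
            ≡⟨ ∑-+ (permutations n) _ _ ⟩
          ∑ₚ (λ σ → n * n * M σ) + ∑ₚ (λ σ → k * (X σ * X σ))
            ≡⟨ cong₂ _+_ (*-∑ (permutations n) (n * n) M) (*-∑ (permutations n) k _) ⟨
          n * n * ∑ₚ M + k * ∑ₚ (λ σ → X σ * X σ) ∎

    -- Symmetry between the sought numbers

    shiftCount≡matches : ∀ (σ : Vec (Fin n) n) h → shiftCount σ h ≡ matches h σ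
    shiftCount≡matches σ h = trans (count-∑ (λ ℓ → ℓ Fin.≟ lookup σ (ℓ ⊕ h)) id id)
      (∑-cong (List.allFin n) (λ ℓ → ⟦⟧-cong (ℓ Fin.≟ lookup σ (ℓ ⊕ h)) (lookup σ (ℓ ⊕ h) Fin.≟ ℓ) sym sym))

    -- The shift `d` is meant to be the negative of `c`. With both as parameters, the inverse
    -- conjugation is obtained by exchanging them, and no double negative has to be simplified.
    conjugate : Fin n → Fin n → Vec (Fin n) n → Vec (Fin n) n
    conjugate c d σ = Vec.tabulate (λ i → lookup σ (i ⊕ d) ⊕ c)

    lookup-conjugate : ∀ {c d : Fin n} → (∀ i → (i ⊕ c) ⊕ d ≡ i) →
                       ∀ σ i → lookup (conjugate c d σ) (i ⊕ c) ≡ lookup σ i ⊕ c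
    lookup-conjugate {c} {d} c-d σ i = trans (lookup∘tabulate _ (i ⊕ c)) (cong (λ t → lookup σ t ⊕ c) (c-d i))

    conjugate-inverse : ∀ {c d : Fin n} → (∀ i → (i ⊕ c) ⊕ d ≡ i) →
                        ∀ σ → conjugate d c (conjugate c d σ) ≡ σ
    conjugate-inverse {c} {d} c-d σ = trans
      (tabulate-cong (λ i → trans (cong (_⊕ d) (lookup-conjugate c-d σ i)) (c-d (lookup σ i)))) (tabulate∘lookup σ)

    conjugate-unique : ∀ {c d : Fin n} → (∀ i → (i ⊕ c) ⊕ d ≡ i) → (∀ i → (i ⊕ d) ⊕ c ≡ i) →
                       ∀ {σ} → Unique σ → Unique (conjugate c d σ)
    conjugate-unique {c} {d} c-d d-c u = UV.tabulate⁺ (λ {i} {j} eq → ⊕-cancelʳ d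
      (UV.lookup-injective u (i ⊕ d) (j ⊕ d) (⊕-cancelʳ c eq)))

    ⊕-swap : ∀ (i c h : Fin n) → (i ⊕ c) ⊕ h ≡ (i ⊕ h) ⊕ c
    ⊕-swap i c h = trans (⊕-assoc i c h) (trans (cong (i ⊕_) (⊕-comm c h)) (sym (⊕-assoc i h c)))

    conjugate-at : ∀ {c d : Fin n} → (∀ i → (i ⊕ c) ⊕ d ≡ i) →
                   ∀ σ h ℓ → at (cell h (ℓ ⊕ c)) (conjugate c d σ) ≡ at (cell h ℓ) σ
    conjugate-at {c} {d} c-d σ h ℓ = ⟦⟧-cong (lookup (conjugate c d σ) ((ℓ ⊕ c) ⊕ h) Fin.≟ (ℓ ⊕ c))
        (lookup σ (ℓ ⊕ h) Fin.≟ ℓ)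
      (λ e → ⊕-cancelʳ c (trans (sym shifted) e)) (λ e → trans shifted (cong (_⊕ c) e))
      where
      shifted : lookup (conjugate c d σ) ((ℓ ⊕ c) ⊕ h) ≡ lookup σ (ℓ ⊕ h) ⊕ c
      shifted = trans (cong (lookup (conjugate c d σ)) (⊕-swap ℓ c h)) (lookup-conjugate c-d σ (ℓ ⊕ h))

    matches-conjugate : ∀ c σ h → matches h (conjugate c (⊖ c) σ) ≡ matches h σ
    matches-conjugate c σ h = trans
      (sym (∑-reindex (_⊕ c) (_⊕ (⊖ c)) (UL.allFin⁺ n) (λ _ → ∈-allFin _) (λ _ → ∈-allFin _)
        (λ i → ⊖-⊕ i c) (λ i → ⊕-⊖ i c) (λ ℓ → at (cell h ℓ) (conjugate c (⊖ c) σ))))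
      (∑-cong (List.allFin n) (conjugate-at (λ i → ⊕-⊖ i c) σ h))

    ∑ₚ-conjugate : ∀ c f → ∑ₚ (f ∘ conjugate c (⊖ c)) ≡ ∑ₚ f
    ∑ₚ-conjugate c = ∑-reindex (conjugate c (⊖ c)) (conjugate (⊖ c) c) (permutations-unique n)
      (λ σ∈ → ∈-permutations⁺ (conjugate-unique (λ i → ⊕-⊖ i c) (λ i → ⊖-⊕ i c) (∈-permutations⁻ σ∈)))
      (λ σ∈ → ∈-permutations⁺ (conjugate-unique (λ i → ⊖-⊕ i c) (λ i → ⊕-⊖ i c) (∈-permutations⁻ σ∈)))
      (conjugate-inverse (λ i → ⊖-⊕ i c)) (conjugate-inverse (λ i → ⊕-⊖ i c))

    module _ (H : ShiftHint n) where

      #found : Fin n → ℕ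
      #found s = length (filter (found? H s) (permutations n))

      #found-∑ : ∀ s → #found s ≡ ∑ₚ (λ σ → at (cell (hint H σ) s) σ)
      #found-∑ s = ∑-filter (found? H s) (permutations n)

      -- Conjugation by a shift preserves all counts, hence the hint.
      #found-⊕ : ∀ s c → #found (s ⊕ c) ≡ #found s
      #found-⊕ s c = trans (#found-∑ (s ⊕ c)) (trans
        (sym (∑ₚ-conjugate c (λ σ → at (cell (hint H σ) (s ⊕ c)) σ)))
        (trans (∑-cong-∈ (permutations n) (λ {σ} σ∈ → trans
            (cong (λ h → at (cell h (s ⊕ c)) (conjugate c (⊖ c) σ)) (sameHint (∈-permutations⁻ σ∈)))
            (conjugate-at (λ i → ⊕-⊖ i c) σ (hint H σ) s)))
          (sym (#found-∑ s))))
        where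
        sameHint : ∀ {σ} → Unique σ → hint H (conjugate c (⊖ c) σ) ≡ hint H σ
        sameHint {σ} u = tieBreak H (conjugate-unique (λ i → ⊕-⊖ i c) (λ i → ⊖-⊕ i c) u) u (λ k →
          trans (shiftCount≡matches (conjugate c (⊖ c) σ) k) (trans (matches-conjugate c σ k)
              (sym (shiftCount≡matches σ k))))

      -- As all sought numbers are found equally often, the left side is a sum over all of them. For
      -- a fixed σ, the numbers that would be found are precisely the matches under the hint.
      n*#found : ∀ s → n * #found s ≡ ∑ₚ (λ σ → matches (hint H σ) σ)
      n*#found s = begin
        n * #found s
          ≡⟨ ∑ᶠ-const n _ ⟨
        ∑ᶠ {n} (λ _ → #found s)
          ≡⟨ ∑-cong (List.allFin n) (λ t → trans (sym (#found-⊕ s (t ⊕ (⊖ s))))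
               (cong #found (trans (⊕-comm s _) (⊖-⊕ t s)))) ⟩
        ∑ᶠ #found
          ≡⟨ ∑-cong (List.allFin n) #found-∑ ⟩
        ∑ᶠ (λ t → ∑ₚ (λ σ → at (cell (hint H σ) t) σ))
          ≡⟨ ∑-swap (permutations n) (List.allFin n) _ ⟨
        ∑ₚ (λ σ → matches (hint H σ) σ) ∎
        where open ≡-Reasoning

      n*#found-≥ : ∀ s k → 1 ≤ k → (k + k) * (k + k) * suc (k + k) ≤ n → (k + k) * suc (k + k) ^ k ≤ n →
                   k * #permutations n ≤ n * #found s + #permutations n
      n*#found-≥ s k 1≤k le₁ le₂ = ≤-trans
        (∑ₚ-maximum k 1≤k le₁ le₂ (λ σ → matches (hint H σ) σ) (λ {σ} u h →
          subst₂ _≤_ (shiftCount≡matches σ h) (shiftCount≡matches σ (hint H σ)) (maximizes H u h)))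
        (≤-reflexive (cong (_+ #permutations n) (sym (n*#found s))))

  -- Logarithms

  2^k≤n⇒k≤log₂n : ∀ {k n} → 2 ^ k ≤ n → k ≤ ⌊log₂ n ⌋
  2^k≤n⇒k≤log₂n {k} le = subst (_≤ _) (⌊log₂[2^n]⌋≡n k) (⌊log₂⌋-mono-≤ le)

  n<2^[1+log₂n] : ∀ n → n < 2 ^ suc ⌊log₂ n ⌋
  n<2^[1+log₂n] n = ≰⇒> (λ le → 1+n≰n (2^k≤n⇒k≤log₂n le))

  2^log₂n≤n : ∀ n .{{_ : NonZero n}} → 2 ^ ⌊log₂ n ⌋ ≤ n
  2^log₂n≤n n = go ⌊log₂ n ⌋ n refl
    where
    -- The induction is on the logarithm, which halving `n` lowers by exactly one.
    go : ∀ t n .{{_ : NonZero n}} → ⌊log₂ n ⌋ ≡ t → 2 ^ t ≤ n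
    go zero    n@(suc _)       _  = s≤s z≤n
    go (suc t) (suc (suc n)) eq = begin
      2 * 2 ^ t                          ≤⟨ *-monoʳ-≤ 2 (go t (suc ⌊ n /2⌋)
                                              (trans (⌊log₂⌊n/2⌋⌋≡⌊log₂n⌋∸1 (suc (suc n))) (cong (_∸ 1) eq))) ⟩
      2 * half                           ≡⟨ cong (half +_) (+-identityʳ half) ⟩
      half + half                        ≤⟨ +-monoʳ-≤ half (⌊n/2⌋≤⌈n/2⌉ (suc (suc n))) ⟩
      half + ⌈ suc (suc n) /2⌉           ≡⟨ ⌊n/2⌋+⌈n/2⌉≡n (suc (suc n)) ⟩
      suc (suc n)                        ∎
      where
      open ≤-Reasoning
      half = ⌊ suc (suc n) /2⌋

  n<2^n : ∀ n → n < 2 ^ n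
  n<2^n zero    = s≤s z≤n
  n<2^n (suc n) = begin
    suc (suc n)       ≤⟨ +-mono-≤ (m^n>0 2 n) (n<2^n n) ⟩
    2 ^ n + 2 ^ n     ≡⟨ cong (2 ^ n +_) (sym (+-identityʳ (2 ^ n))) ⟩
    2 * 2 ^ n         ∎
    where open ≤-Reasoning

  -- The inequality ℓ (ℓ + 1) ≤ 2^ℓ holds from ℓ = 5 on, but at ℓ = 4 it would read 20 ≤ 16. Since
  -- 2^ℓ ≤ m, it makes m large against ℓ², which absorbs all rounding.
  n[n+1]≤2^n : ∀ e → (5 + e) * (6 + e) ≤ 2 ^ (5 + e)
  n[n+1]≤2^n zero    = ≤ᵇ⇒≤ 30 32 _
  n[n+1]≤2^n (suc e) = begin
    (6 + e) * (7 + e)                          ≤⟨ m≤m+n _ ((6 + e) * (3 + e)) ⟩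
    (6 + e) * (7 + e) + (6 + e) * (3 + e)      ≡⟨ solve 1 (λ e → (con 6 :+ e) :* (con 7 :+ e) :+ (con 6 :+ e) :* (con 3 :+ e)
                                                    := con 2 :* ((con 5 :+ e) :* (con 6 :+ e))) refl e ⟩
    2 * ((5 + e) * (6 + e))                    ≤⟨ *-monoʳ-≤ 2 (n[n+1]≤2^n e) ⟩
    2 * 2 ^ (5 + e)                            ∎
    where open ≤-Reasoning

  log₂log₂ : ℕ → ℕ
  log₂log₂ n = ⌊log₂ ⌊log₂ n ⌋ ⌋

  -- The choice of the tuple length

  module _ {n : ℕ} .{{_ : NonZero n}} (H : ShiftHint n) (s : Fin n) where

    -- With ℓ = 5 + e, the numerals stand for ℓ - 4 = `suc e`, ℓ = `5 + e`, ℓ + 1 = `6 + e` and ℓ +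
    -- 3 = `8 + e`. The mean maximum is at least k - 1 ≥ (m + 1)/(ℓ + 3) - 2, and the loss of 2 is
    -- at most 2 (m + 1)/(ℓ (ℓ + 1)).
    n*#found-log : ∀ e → log₂log₂ n ≡ 5 + e →
                   suc e * suc ⌊log₂ n ⌋ * #permutations n ≤ (5 + e) * (6 + e) * (n * #found H s)
    n*#found-log e eq = *-cancelˡ-≤ (8 + e) (+-cancelʳ-≤ (2 * ((5 + e) * (6 + e) * (8 + e)) * N) _ _ (begin
      (8 + e) * (suc e * suc m * N) + 2 * ((5 + e) * (6 + e) * (8 + e)) * N
        ≤⟨ +-monoʳ-≤ ((8 + e) * (suc e * suc m * N)) (*-monoˡ-≤ N (*-monoʳ-≤ 2 (*-monoˡ-≤ (8 + e)
            (≤-trans (n[n+1]≤2^n e) (≤-trans 2^ℓ≤m (n≤1+n m)))))) ⟩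
      (8 + e) * (suc e * suc m * N) + 2 * (suc m * (8 + e)) * N
        -- The loss is affordable because (ℓ - 4)(ℓ + 3) + 2 (ℓ + 3) = ℓ (ℓ + 1) - 6. With 3 in
        -- place of 4 the left side would outgrow ℓ (ℓ + 1).
        ≤⟨ m≤m+n _ (6 * (suc m * N)) ⟩
      (8 + e) * (suc e * suc m * N) + 2 * (suc m * (8 + e)) * N + 6 * (suc m * N)
        ≡⟨ solve 3 (λ e m N → (con 8 :+ e) :* ((con 1 :+ e) :* (con 1 :+ m) :* N)
            :+ con 2 :* ((con 1 :+ m) :* (con 8 :+ e)) :* N
             :+ con 6 :* ((con 1 :+ m) :* N)
             := (con 5 :+ e) :* (con 6 :+ e) :* ((con 1 :+ m) :* N)) refl e m N ⟩
      (5 + e) * (6 + e) * (suc m * N)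
        ≤⟨ *-monoʳ-≤ ((5 + e) * (6 + e)) (*-monoˡ-≤ N m<[1+k][8+e]) ⟩
      (5 + e) * (6 + e) * (suc k * (8 + e) * N)
        ≡⟨ solve 3 (λ e k N → (con 5 :+ e) :* (con 6 :+ e) :* ((con 1 :+ k) :* (con 8 :+ e) :* N)
             := (con 5 :+ e) :* (con 6 :+ e) :* (con 8 :+ e) :* (k :* N :+ N)) refl e k N ⟩
      (5 + e) * (6 + e) * (8 + e) * (k * N + N)
        ≤⟨ *-monoʳ-≤ ((5 + e) * (6 + e) * (8 + e)) (+-monoˡ-≤ N (n*#found-≥ H s k 1≤k cubic power)) ⟩
      (5 + e) * (6 + e) * (8 + e) * (n * #found H s + N + N)
        ≡⟨ solve 3 (λ e f N → (con 5 :+ e) :* (con 6 :+ e) :* (con 8 :+ e) :* (f :+ N :+ N)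
             := (con 8 :+ e) :* ((con 5 :+ e) :* (con 6 :+ e) :* f)
                 :+ con 2 :* ((con 5 :+ e) :* (con 6 :+ e) :* (con 8 :+ e)) :* N)
             refl e (n * #found H s) N ⟩
      (8 + e) * ((5 + e) * (6 + e) * (n * #found H s)) + 2 * ((5 + e) * (6 + e) * (8 + e)) * N ∎))
      where
      open ≤-Reasoning
      N = #permutations n
      m = ⌊log₂ n ⌋
      -- As 2k + 1 ≤ 2^(ℓ+1), the product (2k)(2k+1)^k is at most 2^(2k) · 2^((ℓ+1)k) = 2^(k(ℓ+3)).
      -- The divisor ℓ + 3 brings this below 2^m ≤ n.
      k = m / (8 + e)
      m≢0 : NonZero m
      m≢0 = ≢-nonZero (λ m≡0 → 1+n≢0 (trans (sym eq) (cong ⌊log₂_⌋ m≡0)))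
      2^ℓ≤m : 2 ^ (5 + e) ≤ m
      2^ℓ≤m = subst (λ t → 2 ^ t ≤ m) eq (2^log₂n≤n m {{m≢0}})
      m<2^[1+ℓ] : suc m ≤ 2 ^ (6 + e)
      m<2^[1+ℓ] = subst (λ t → m < 2 ^ suc t) eq (n<2^[1+log₂n] m)
      k[8+e]≤m : k * (8 + e) ≤ m
      k[8+e]≤m = m/n*n≤m m (8 + e)
      m<[1+k][8+e] : suc m ≤ suc k * (8 + e)
      m<[1+k][8+e] = begin
        suc m                          ≡⟨ cong suc (m≡m%n+[m/n]*n m (8 + e)) ⟩
        suc (m % (8 + e)) + k * (8 + e) ≤⟨ +-monoˡ-≤ (k * (8 + e)) (m%n<n m (8 + e)) ⟩
        (8 + e) + k * (8 + e)          ∎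
      square≤m : (5 + e) * (6 + e) ≤ m
      square≤m = ≤-trans (n[n+1]≤2^n e) 2^ℓ≤m
      1≤k : 1 ≤ k
      1≤k = m≥n⇒m/n>0 (≤-trans (≤-trans (m≤m+n (8 + e) (22 + 10 * e + e * e)) (≤-reflexive
        (solve 1 (λ e → con 8 :+ e :+ (con 22 :+ con 10 :* e :+ e :* e) := (con 5 :+ e) :* (con 6 :+ e)) refl e))) square≤m)
      2k+1≤ : suc (k + k) ≤ 2 ^ (6 + e)
      2k+1≤ = ≤-trans (s≤s (≤-trans (≤-trans (≤-reflexive (solve 1 (λ k → k :+ k := k :* con 2) refl k))
        (*-monoʳ-≤ k (s≤s (s≤s (z≤n {6 + e}))))) k[8+e]≤m)) m<2^[1+ℓ]
      2k≤ : k + k ≤ 2 ^ (6 + e)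
      2k≤ = ≤-trans (n≤1+n _) 2k+1≤
      2^m≤n : 2 ^ m ≤ n
      2^m≤n = 2^log₂n≤n n
      cubic : (k + k) * (k + k) * suc (k + k) ≤ n
      cubic = begin
        (k + k) * (k + k) * suc (k + k)               ≤⟨ *-mono-≤ (*-mono-≤ 2k≤ 2k≤) 2k+1≤ ⟩
        2 ^ (6 + e) * 2 ^ (6 + e) * 2 ^ (6 + e)       ≡⟨ cong (_* 2 ^ (6 + e)) (^-distribˡ-+-* 2 (6 + e) (6 + e)) ⟨
        2 ^ (6 + e + (6 + e)) * 2 ^ (6 + e)           ≡⟨ ^-distribˡ-+-* 2 (6 + e + (6 + e)) (6 + e) ⟨
        2 ^ (6 + e + (6 + e) + (6 + e))               ≤⟨ ^-monoʳ-≤ 2 (≤-trans (≤-trans (m≤m+n (6 + e + (6 + e) + (6 + e))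
            (12 + 8 * e + e * e)) (≤-reflexive
          (solve 1 (λ e → con 6 :+ e :+ (con 6 :+ e) :+ (con 6 :+ e) :+ (con 12 :+ con 8 :* e :+ e :* e)
            := (con 5 :+ e) :* (con 6 :+ e)) refl e))) square≤m) ⟩
        2 ^ m                                         ≤⟨ 2^m≤n ⟩
        n                                             ∎
      power : (k + k) * suc (k + k) ^ k ≤ n
      power = begin
        (k + k) * suc (k + k) ^ k                     ≤⟨ *-mono-≤ (<⇒≤ (n<2^n (k + k))) (^-monoˡ-≤ k 2k+1≤) ⟩
        2 ^ (k + k) * (2 ^ (6 + e)) ^ k               ≡⟨ cong (2 ^ (k + k) *_) (^-*-assoc 2 (6 + e) k) ⟩
        2 ^ (k + k) * 2 ^ ((6 + e) * k)               ≡⟨ ^-distribˡ-+-* 2 (k + k) ((6 + e) * k) ⟨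
        2 ^ (k + k + (6 + e) * k)                     ≡⟨ cong (2 ^_)
            (solve 2 (λ k e → k :+ k :+ (con 6 :+ e) :* k := k :* (con 8 :+ e)) refl k e) ⟩
        2 ^ (k * (8 + e))                             ≤⟨ ^-monoʳ-≤ 2 k[8+e]≤m ⟩
        2 ^ m                                         ≤⟨ 2^m≤n ⟩
        n                                             ∎

    -- Up to ℓ = 4 the truncated difference makes the left side zero, so the bound covers the small
    -- `n` as well.
    #found-bound : (log₂log₂ n ∸ 4) * suc ⌊log₂ n ⌋ * #permutations n
                   ≤ log₂log₂ n * suc (log₂log₂ n) * (n * #found H s)
    #found-bound with log₂log₂ n in eq
    ... | 0 = z≤n
    ... | 1 = z≤n
    ... | 2 = z≤n
    ... | 3 = z≤n
    ... | 4 = z≤n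
    ... | suc (suc (suc (suc (suc e)))) = n*#found-log e eq

-- Rational estimates for logarithms, products and quotients of cuts

module Cuts where

  open import Data.Integer.Base as ℤ using (+_; -[1+_]; +<+; +≤+)
  import Data.Integer.Properties as ℤ
  open import Data.Nat.Base as ℕ using (ℕ; zero; suc; NonZero)
  import Data.Nat.Properties as ℕ
  import Data.Nat.Coprimality as Coprime
  open import Data.Product.Base using (_,_; _×_; ∃-syntax)
  open import Data.Rational.Base hiding (NonZero)
  open import Data.Rational.Properties
  import Data.Rational.Unnormalised.Base as ℚᵘ
  import Data.Rational.Unnormalised.Properties as ℚᵘ
  open import Algebra.Definitions.RawSemiring +-*-rawSemiring using (_^_)

  <⇒≱ : ∀ {p q : ℚ} → p < q → ¬ q ≤ p
  <⇒≱ p<q q≤p = <-irrefl refl (<-≤-trans p<q q≤p)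

  ι : ℕ → ℚ
  ι n = + n / 1

  -- The quotient by 1 is normalised through a gcd that does not compute for a variable `n`; this
  -- form exposes numerator and denominator.
  ι-mkℚ : ∀ n → ι n ≡ mkℚ (+ n) 0 (Coprime.sym (Coprime.1-coprimeTo n))
  ι-mkℚ n = ↥p/↧p≡p (mkℚ (+ n) 0 (Coprime.sym (Coprime.1-coprimeTo n)))

  ι-* : ∀ m n → ι (m ℕ.* n) ≡ ι m * ι n
  ι-* m n = trans (cong (_/ 1) (ℤ.pos-* m n)) (sym (cong₂ _*_ (ι-mkℚ m) (ι-mkℚ n)))

  ι-+ : ∀ m n → ι (m ℕ.+ n) ≡ ι m + ι n
  ι-+ m n = trans (cong (_/ 1) (trans (ℤ.pos-+ m n) (sym (cong₂ ℤ._+_ (ℤ.*-identityʳ (+ m)) (ℤ.*-identityʳ (+ n))))))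
    (sym (cong₂ _+_ (ι-mkℚ m) (ι-mkℚ n)))

  ι-^ : ∀ m k → ι (m ℕ.^ k) ≡ ι m ^ k
  ι-^ m zero    = refl
  ι-^ m (suc k) = trans (ι-* m (m ℕ.^ k)) (cong (ι m *_) (ι-^ m k))

  <ι : ∀ {p u t} → ↥ p ≡ + u → u ℕ.< t ℕ.* ↧ₙ p → p < ι t
  <ι {p} {u} {t} eq lt rewrite ι-mkℚ t = *<* (subst₂ ℤ._<_
    (sym (trans (ℤ.*-identityʳ (↥ p)) eq)) (ℤ.pos-* t (↧ₙ p)) (+<+ lt))

  ι< : ∀ {p u t} → ↥ p ≡ + u → t ℕ.* ↧ₙ p ℕ.< u → ι t < p
  ι< {p} {u} {t} eq lt rewrite ι-mkℚ t = *<* (subst₂ ℤ._<_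
    (ℤ.pos-* t (↧ₙ p)) (sym (trans (ℤ.*-identityʳ (↥ p)) eq)) (+<+ lt))

  ι-mono-≤ : ∀ {m n} → m ℕ.≤ n → ι m ≤ ι n
  ι-mono-≤ {m} {n} m≤n rewrite ι-mkℚ m | ι-mkℚ n = *≤* (subst₂ ℤ._≤_
    (sym (ℤ.*-identityʳ (+ m))) (sym (ℤ.*-identityʳ (+ n))) (+≤+ m≤n))

  ι-mono-< : ∀ {m n} → m ℕ.< n → ι m < ι n
  ι-mono-< {m} {n} m<n rewrite ι-mkℚ m | ι-mkℚ n = *<* (subst₂ ℤ._<_
    (sym (ℤ.*-identityʳ (+ m))) (sym (ℤ.*-identityʳ (+ n))) (+<+ m<n))

  ι-cancel-< : ∀ {m n} → ι m < ι n → m ℕ.< n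
  ι-cancel-< lt = ℕ.≰⇒> (λ n≤m → <⇒≱ lt (ι-mono-≤ n≤m))

  0≤ι : ∀ n → 0ℚ ≤ ι n
  0≤ι n = ι-mono-≤ {0} {n} ℕ.z≤n

  -- Fractions are handled only through this equation, which clears the denominator. Unnormalised
  -- fractions keep the gcd out of its proof.
  /-*-ι : ∀ a d .{{_ : NonZero d}} → (+ a / d) * ι d ≡ ι a
  /-*-ι a d@(suc k) = toℚᵘ-injective (begin
    toℚᵘ ((+ a / d) * ι d)               ≈⟨ toℚᵘ-homo-* (+ a / d) (ι d) ⟩
    toℚᵘ (+ a / d) ℚᵘ.* toℚᵘ (ι d)       ≈⟨ ℚᵘ.*-cong (toℚᵘ-fromℚᵘ (ℚᵘ.mkℚᵘ (+ a) k)) (toℚᵘ-fromℚᵘ (ℚᵘ.mkℚᵘ (+ d) 0)) ⟩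
    ℚᵘ.mkℚᵘ (+ a) k ℚᵘ.* ℚᵘ.mkℚᵘ (+ d) 0 ≈⟨ ℚᵘ.*≡* (trans (ℤ.*-identityʳ (+ a ℤ.* + d))
        (cong (λ t → + a ℤ.* + t) (sym (ℕ.*-identityʳ d)))) ⟩
    ℚᵘ.mkℚᵘ (+ a) 0                      ≈⟨ toℚᵘ-fromℚᵘ (ℚᵘ.mkℚᵘ (+ a) 0) ⟨
    toℚᵘ (ι a)                           ∎)
    where open ℚᵘ.≃-Reasoning

  *-monoʳ-≤′ : ∀ {r p q} → 0ℚ ≤ r → p ≤ q → r * p ≤ r * q
  *-monoʳ-≤′ {r} 0≤r = *-monoˡ-≤-nonNeg r {{nonNegative 0≤r}}

  *-mono-≤′ : ∀ {p q r s} → 0ℚ ≤ p → 0ℚ ≤ s → p ≤ q → r ≤ s → p * r ≤ q * s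
  *-mono-≤′ {p} {q} {r} {s} 0≤p 0≤s p≤q r≤s =
    ≤-trans (*-monoʳ-≤′ 0≤p r≤s) (*-monoʳ-≤-nonNeg s {{nonNegative 0≤s}} p≤q)

  *-nonNeg : ∀ {p q} → 0ℚ ≤ p → 0ℚ ≤ q → 0ℚ ≤ p * q
  *-nonNeg {p} 0≤p 0≤q = ≤-trans (≤-reflexive (sym (*-zeroʳ p))) (*-monoʳ-≤′ 0≤p 0≤q)

  *-pos : ∀ {p q} → 0ℚ < p → 0ℚ < q → 0ℚ < p * q
  *-pos {p} 0<p 0<q = ≤-<-trans (≤-reflexive (sym (*-zeroʳ p))) (*-monoʳ-<-pos p {{positive 0<p}} 0<q)

  *-pos-nonPos : ∀ {p q} → 0ℚ ≤ p → q ≤ 0ℚ → p * q ≤ 0ℚ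
  *-pos-nonPos {p} 0≤p q≤0 = ≤-trans (*-monoʳ-≤′ 0≤p q≤0) (≤-reflexive (*-zeroʳ p))

  ^-nonNeg : ∀ {p} k → 0ℚ ≤ p → 0ℚ ≤ p ^ k
  ^-nonNeg zero    0≤p = nonNegative⁻¹ 1ℚ
  ^-nonNeg (suc k) 0≤p = *-nonNeg 0≤p (^-nonNeg k 0≤p)

  ^-mono-≤ : ∀ {p q} k → 0ℚ ≤ p → p ≤ q → p ^ k ≤ q ^ k
  ^-mono-≤ zero    0≤p p≤q = ≤-refl
  ^-mono-≤ (suc k) 0≤p p≤q = *-mono-≤′ 0≤p (^-nonNeg k (≤-trans 0≤p p≤q)) p≤q (^-mono-≤ k 0≤p p≤q)

  ½^≤1 : ∀ k → ½ ^ k ≤ 1ℚ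
  ½^≤1 zero    = ≤-refl
  ½^≤1 (suc k) = *-mono-≤′ {½} {1ℚ} {½ ^ k} {1ℚ} (nonNegative⁻¹ ½) (nonNegative⁻¹ 1ℚ)
      (<⇒≤ (*<* (+<+ (ℕ.s≤s (ℕ.s≤s ℕ.z≤n))))) (½^≤1 k)

  -- For c = u/d ≥ 0, the chain 2^u < r^d ≤ n^d ≤ 2^(td) compares exponents. A negative c lies below
  -- `ι t` by its sign.
  log₂-lower : ∀ {n t} → n ℕ.≤ 2 ℕ.^ t → ∀ {c} → lower (log₂ (fromℕ n)) c → c < ι t
  log₂-lower {n} {t} n≤2^t {mkℚ -[1+ u ] d cop} _ = <-≤-trans (negative⁻¹ (mkℚ -[1+ u ] d cop)) (0≤ι t)
  log₂-lower {n} {t} n≤2^t {c@(mkℚ (+ u) d-1 _)} (r , r<n , 0<r , 2^u<r^d) =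
    <ι {c} {u} {t} refl (ℕ.≰⇒> (λ td≤u → ℕ.<⇒≱ 2^u<2^td (ℕ.^-monoʳ-≤ 2 td≤u)))
    where
    d = suc d-1
    2^u<2^td : 2 ℕ.^ u ℕ.< 2 ℕ.^ (t ℕ.* d)
    2^u<2^td = ℕ.<-≤-trans (ι-cancel-< (<-≤-trans (subst (_< r ^ d) (sym (ι-^ 2 u)) 2^u<r^d)
        (≤-trans (^-mono-≤ d (<⇒≤ 0<r) (<⇒≤ r<n)) (≤-reflexive (sym (ι-^ n d))))))
      (ℕ.≤-trans (ℕ.^-monoˡ-≤ d n≤2^t) (ℕ.≤-reflexive (ℕ.^-*-assoc 2 t d)))

  -- The argument `x` is any cut whose upper rationals exceed `n`, so that the lemma can be applied
  -- to its own result and reach the iterated logarithm. A negative numerator of `c` is impossible,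
  -- because 2^(td) is at least 1.
  log₂-upper : ∀ {x n t} → (∀ {r} → upper x r → ι n < r) → 2 ℕ.^ t ℕ.≤ n →
               ∀ {c} → upper (log₂ x) c → ι t < c
  log₂-upper {x} {n} {t} x>n 2^t≤n {c} (r , x<r , _ , r^d<2^c) = go (↥ c) refl
    where
    d = ↧ₙ c
    2^td<2^c : ι (2 ℕ.^ (t ℕ.* d)) < 2^ (↥ c)
    2^td<2^c = ≤-<-trans (begin
      ι (2 ℕ.^ (t ℕ.* d))   ≡⟨ cong ι (sym (ℕ.^-*-assoc 2 t d)) ⟩
      ι ((2 ℕ.^ t) ℕ.^ d)   ≤⟨ ι-mono-≤ (ℕ.^-monoˡ-≤ d 2^t≤n) ⟩
      ι (n ℕ.^ d)           ≡⟨ ι-^ n d ⟩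
      ι n ^ d               ≤⟨ ^-mono-≤ d (0≤ι n) (<⇒≤ (x>n x<r)) ⟩
      r ^ d                 ∎) r^d<2^c
      where open ≤-Reasoning
    go : ∀ z → ↥ c ≡ z → ι t < c
    go (+ u) eq = ι< {c} {u} {t} eq (ℕ.≰⇒> (λ u≤td → ℕ.<⇒≱
      (ι-cancel-< {2 ℕ.^ (t ℕ.* d)} {2 ℕ.^ u} (subst (ι (2 ℕ.^ (t ℕ.* d)) <_)
          (trans (cong 2^_ eq) (sym (ι-^ 2 u))) 2^td<2^c))
      (ℕ.^-monoʳ-≤ 2 u≤td)))
    go -[1+ u ] eq = contradiction (ι-mono-≤ {1} (ℕ.m^n>0 2 (t ℕ.* d)))
      (<⇒≱ (<-≤-trans (subst (ι (2 ℕ.^ (t ℕ.* d)) <_) (cong 2^_ eq) 2^td<2^c) (½^≤1 (suc u))))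

  -- A nonnegative `q` lies below all four corner products. As `b` and `d` are positive, a
  -- nonpositive `a` or `c` would make `a * d` or `b * c` nonpositive. Interval multiplication thus
  -- reduces to the one corner `a * c`.
  *ᴿ-lower : ∀ {x y q} → (∀ {b} → upper x b → 0ℚ < b) → (∀ {d} → upper y d → 0ℚ < d) → 0ℚ ≤ q →
             lower (x *ᴿ y) q → ∃[ a ] ∃[ c ] lower x a × lower y c × 0ℚ < a × 0ℚ < c × q < a * c
  *ᴿ-lower {q = q} x>0 y>0 0≤q (a , b , c , d , x>a , x<b , y>c , y<d , lt) =
    a , c , x>a , y>c , ≰⇒> a≰0 , ≰⇒> c≰0 , <-≤-trans lt ac
    where
    S₂ = (a * c) ⊓ (a * d)
    S₃ = S₂ ⊓ (b * c)
    s₃ : S₃ ⊓ (b * d) ≤ S₃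
    s₃ = p⊓q≤p S₃ (b * d)
    s₂ : S₃ ⊓ (b * d) ≤ S₂
    s₂ = ≤-trans s₃ (p⊓q≤p S₂ (b * c))
    ac : S₃ ⊓ (b * d) ≤ a * c
    ac = ≤-trans s₂ (p⊓q≤p (a * c) (a * d))
    a≰0 : ¬ a ≤ 0ℚ
    a≰0 a≤0 = <⇒≱ (≤-<-trans 0≤q lt) (≤-trans s₂ (≤-trans (p⊓q≤q (a * c) (a * d))
      (≤-trans (≤-reflexive (*-comm a d)) (*-pos-nonPos (<⇒≤ (y>0 y<d)) a≤0))))
    c≰0 : ¬ c ≤ 0ℚ
    c≰0 c≤0 = <⇒≱ (≤-<-trans 0≤q lt) (≤-trans s₃ (≤-trans (p⊓q≤q S₂ (b * c))
      (*-pos-nonPos (<⇒≤ (x>0 x<b)) c≤0)))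

  *ᴿ-upper : ∀ {x y r} → upper (x *ᴿ y) r → ∃[ b ] ∃[ d ] upper x b × upper y d × b * d < r
  *ᴿ-upper {r = r} (a , b , c , d , _ , x<b , _ , y<d , lt) = b , d , x<b , y<d ,
    ≤-<-trans (p≤q⊔p ((a * c) ⊔ (a * d) ⊔ (b * c)) (b * d)) lt

  recip-upper-pos : ∀ {y d} → upper (recip y) d → 0ℚ < d
  recip-upper-pos {d = d} (r , _ , 0<r , 1<dr) = ≰⇒> (λ d≤0 → <⇒≱ 1<dr
    (≤-trans (≤-reflexive (*-comm d r)) (≤-trans (*-pos-nonPos (<⇒≤ 0<r) d≤0) (nonNegative⁻¹ 1ℚ))))

  *ᴿ-upper-pos : ∀ {x y} → (∀ {b} → upper x b → 0ℚ < b) → (∀ {d} → upper y d → 0ℚ < d) →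
                 ∀ {r} → upper (x *ᴿ y) r → 0ℚ < r
  *ᴿ-upper-pos {x} {y} x>0 y>0 xy<r with *ᴿ-upper {x} {y} xy<r
  ... | b , d , x<b , y<d , bd<r = <-trans (*-pos (x>0 x<b) (y>0 y<d)) bd<r

  *ᴿ-upper-≥ : ∀ {x y p q} → 0ℚ ≤ p → 0ℚ ≤ q → (∀ {b} → upper x b → p ≤ b) → (∀ {d} → upper y d → q ≤ d) →
               ∀ {r} → upper (x *ᴿ y) r → p * q ≤ r
  *ᴿ-upper-≥ {x} {y} 0≤p 0≤q x≥p y≥q xy<r with *ᴿ-upper {x} {y} xy<r
  ... | b , d , x<b , y<d , bd<r =
    ≤-trans (*-mono-≤′ 0≤p (≤-trans 0≤q (y≥q y<d)) (x≥p x<b) (y≥q y<d)) (<⇒≤ bd<r)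

  *ᴿ-lower-≤ : ∀ {x y p q} → (∀ {b} → upper x b → 0ℚ < b) → (∀ {d} → upper y d → 0ℚ < d) → 0ℚ ≤ q →
               (∀ {a} → lower x a → a ≤ p) → (∀ {c} → lower y c → c ≤ q) →
               ∀ {r} → 0ℚ ≤ r → lower (x *ᴿ y) r → r ≤ p * q
  *ᴿ-lower-≤ {x} {y} x>0 y>0 0≤q x≤p y≤q 0≤r r<xy with *ᴿ-lower {x} {y} x>0 y>0 0≤r r<xy
  ... | a , c , a<x , c<y , 0<a , _ , r<ac =
    ≤-trans (<⇒≤ r<ac) (*-mono-≤′ (<⇒≤ 0<a) 0≤q (x≤p a<x) (y≤q c<y))

  -- A negative `q` is below `P` at once. Any other `q` is below some `a * c` with `a` at most `p`
  -- and `c` below the reciprocal of `y`, hence `c * w ≤ 1`. The last premise is the purely rational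
  -- claim that remains.
  /ᴿ-≤ : ∀ {x y p w P} → 0ℚ ≤ P → (∀ {b} → upper x b → 0ℚ < b) →
         (∀ {a} → 0ℚ ≤ a → lower x a → a ≤ p) → (∀ {r} → upper y r → w ≤ r) →
         (∀ {q c} → 0ℚ ≤ c → c * w ≤ 1ℚ → q < p * c → q < P) →
         fromℚ P ≥ᴿ x /ᴿ y
  /ᴿ-≤ {x} {y} 0≤P x>0 x≤p y≥w <P q q<x/y with q <? 0ℚ
  ... | yes q<0 = <-≤-trans q<0 0≤P
  ... | no q≮0 with *ᴿ-lower {x} {recip y} x>0 (recip-upper-pos {y}) (≮⇒≥ q≮0) q<x/y
  ...   | a , c , a<x , (r , y<r , cr<1) , 0<a , 0<c , q<ac = <P (<⇒≤ 0<c)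
    (≤-trans (*-monoʳ-≤′ (<⇒≤ 0<c) (y≥w y<r)) (<⇒≤ cr<1))
    (<-≤-trans q<ac (*-monoʳ-≤-nonNeg c {{nonNegative (<⇒≤ 0<c)}} (x≤p (<⇒≤ 0<a) a<x)))

-- The error term and the passage to real numbers

open Counting
open Cuts
open import Data.Integer.Base using (+_; -[1+_]; +<+)
open import Data.Nat.Base as ℕ using (ℕ; NonZero; _≤_; suc; zero)
import Data.Nat.Properties as ℕ
open import Data.Nat.Logarithm using (⌊log₂_⌋)
open import Data.Product.Base using (Σ-syntax; _×_; _,_)
open import Data.Rational.Base as ℚ using (ℚ; 0ℚ; 1ℚ; _+_; _*_; -_; _/_; ∣_∣; mkℚ; ↧ₙ_)
import Data.Rational.Properties as ℚ
open import Data.Rational.Solver using (module +-*-Solver)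
open +-*-Solver using (solve; _:=_; _:+_; _:*_; :-_; con)

-- The minimum with 5 mirrors the truncation in ℓ ∸ 4: for ℓ ≤ 4 the fraction is 1, so 1 + δ is 0
-- and never negative.
β δ : ℕ → ℚ
β n = + (5 ℕ.⊓ suc (log₂log₂ n)) / suc (log₂log₂ n)
δ n = - β n

0<ι-suc : ∀ n → 0ℚ ℚ.< ι (suc n)
0<ι-suc n = ι-mono-< {0} {suc n} (ℕ.s≤s ℕ.z≤n)

0≤β : ∀ n → 0ℚ ℚ.≤ β n
0≤β n = ℚ.*-cancelʳ-≤-pos (ι L) {{ℚ.positive (0<ι-suc (log₂log₂ n))}} (begin
  0ℚ * ι L        ≡⟨ ℚ.*-zeroˡ (ι L) ⟩
  0ℚ              ≤⟨ 0≤ι (5 ℕ.⊓ L) ⟩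
  ι (5 ℕ.⊓ L)     ≡⟨ /-*-ι (5 ℕ.⊓ L) L ⟨
  β n * ι L       ∎)
  where
  open ℚ.≤-Reasoning
  L = suc (log₂log₂ n)

1≤p*↧p : ∀ p → 0ℚ ℚ.< p → 1ℚ ℚ.≤ p * ι (↧ₙ p)
1≤p*↧p p@(mkℚ (+ suc u) d-1 _) _ = ℚ.≤-trans (ι-mono-≤ {1} {suc u} (ℕ.s≤s ℕ.z≤n))
  (ℚ.≤-reflexive (trans (sym (/-*-ι (suc u) (suc d-1))) (cong (_* ι (suc d-1)) (ℚ.↥p/↧p≡p p))))
1≤p*↧p (mkℚ (+ zero) _ _) (ℚ.*<* (+<+ ()))
1≤p*↧p (mkℚ -[1+ _ ] _ _) (ℚ.*<* ())

δ⟶0 : δ ⟶0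
δ⟶0 ε 0<ε = 2 ℕ.^ (2 ℕ.^ t) , λ n le → begin-strict
  ∣ - β n ∣   ≡⟨ ℚ.∣-p∣≡∣p∣ (β n) ⟩
  ∣ β n ∣     ≡⟨ ℚ.0≤p⇒∣p∣≡p (0≤β n) ⟩
  β n         <⟨ β<ε n (2^k≤n⇒k≤log₂n {t} (2^k≤n⇒k≤log₂n {2 ℕ.^ t} le)) ⟩
  ε           ∎
  where
  open ℚ.≤-Reasoning
  d = ↧ₙ ε
  -- A positive ε with denominator d is at least 1/d, and 5/(ℓ + 1) < 1/d as soon as ℓ ≥ 5d. Two
  -- exponentials turn this bound on ℓ into one on n.
  t = 5 ℕ.* d
  β<ε : ∀ n → t ℕ.≤ log₂log₂ n → β n ℚ.< ε
  β<ε n t≤ = ℚ.*-cancelʳ-<-nonNeg (ι L * ι d) {{ℚ.nonNegative (*-nonNeg (0≤ι L) (0≤ι d))}} (begin-strict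
    β n * (ι L * ι d)          ≡⟨ ℚ.*-assoc (β n) (ι L) (ι d) ⟨
    β n * ι L * ι d            ≡⟨ cong (_* ι d) (/-*-ι (5 ℕ.⊓ L) L) ⟩
    ι (5 ℕ.⊓ L) * ι d          ≡⟨ ι-* (5 ℕ.⊓ L) d ⟨
    ι ((5 ℕ.⊓ L) ℕ.* d)        <⟨ ι-mono-< {(5 ℕ.⊓ L) ℕ.* d} {L} (ℕ.s≤s (ℕ.≤-trans (ℕ.*-monoˡ-≤ d (ℕ.m⊓n≤m 5 L)) t≤)) ⟩
    ι L                        ≡⟨ ℚ.*-identityʳ (ι L) ⟨
    ι L * 1ℚ                   ≤⟨ *-monoʳ-≤′ (0≤ι L) (1≤p*↧p ε 0<ε) ⟩
    ι L * (ε * ι d)            ≡⟨ solve 3 (λ L e d → L :* (e :* d) := e :* (L :* d)) refl (ι L) ε (ι d) ⟩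
    ε * (ι L * ι d)            ∎)
    where L = suc (log₂log₂ n)

[1+δ]*ι : ∀ n → (1ℚ + δ n) * ι (suc (log₂log₂ n)) ≡ ι (log₂log₂ n ℕ.∸ 4)
[1+δ]*ι n = begin
  (1ℚ + - β n) * ι L              ≡⟨ solve 2 (λ b l → (con 1ℚ :+ :- b) :* l := l :+ :- (b :* l)) refl (β n) (ι L) ⟩
  ι L + - (β n * ι L)             ≡⟨ cong (λ t → ι L + - t) (/-*-ι (5 ℕ.⊓ L) L) ⟩
  ι L + - ι (5 ℕ.⊓ L)             ≡⟨ cong (λ t → t + - ι (5 ℕ.⊓ L)) (trans (cong ι (sym (ℕ.m⊓n+n∸m≡n 5 L)))
      (ι-+ (5 ℕ.⊓ L) (L ℕ.∸ 5))) ⟩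
  ι (5 ℕ.⊓ L) + ι (L ℕ.∸ 5) + - ι (5 ℕ.⊓ L)
                                  ≡⟨ solve 2 (λ a b → a :+ b :+ :- a := b) refl (ι (5 ℕ.⊓ L)) (ι (L ℕ.∸ 5)) ⟩
  ι (L ℕ.∸ 5)                     ∎
  where
  open ≡-Reasoning
  L = suc (log₂log₂ n)

0≤1+δ : ∀ n → 0ℚ ℚ.≤ 1ℚ + δ n
0≤1+δ n = ℚ.*-cancelʳ-≤-pos (ι L) {{ℚ.positive (0<ι-suc (log₂log₂ n))}} (begin
  0ℚ * ι L                   ≡⟨ ℚ.*-zeroˡ (ι L) ⟩
  0ℚ                         ≤⟨ 0≤ι (L ℕ.∸ 5) ⟩
  ι (L ℕ.∸ 5)                ≡⟨ [1+δ]*ι n ⟨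
  (1ℚ + δ n) * ι L           ∎)
  where
  open ℚ.≤-Reasoning
  L = suc (log₂log₂ n)

Pr-*-ι : ∀ {n} .{{_ : NonZero n}} (H : ShiftHint n) s → Pr (found? H s) * ι (#permutations n) ≡ ι (#found H s)
Pr-*-ι {n} H s = /-*-ι (#found H s) (#permutations n) {{permutations-nonZero n}}

0<ι-#permutations : ∀ n → 0ℚ ℚ.< ι (#permutations n)
0<ι-#permutations n = ι-mono-< {0} {#permutations n} (ℕ.>-nonZero⁻¹ _ {{permutations-nonZero n}})

0≤Pr : ∀ {n} .{{_ : NonZero n}} (H : ShiftHint n) s → 0ℚ ℚ.≤ Pr (found? H s)
0≤Pr {n} H s = ℚ.*-cancelʳ-≤-pos (ι N) {{ℚ.positive (0<ι-#permutations n)}} (begin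
  0ℚ * ι N                ≡⟨ ℚ.*-zeroˡ (ι N) ⟩
  0ℚ                      ≤⟨ 0≤ι (#found H s) ⟩
  ι (#found H s)          ≡⟨ Pr-*-ι H s ⟨
  Pr (found? H s) * ι N   ∎)
  where
  open ℚ.≤-Reasoning
  N = #permutations n

-- In substance α = A/L, P = f/N and c is at most 1/(nℓ); multiplying by N · L avoids every
-- division. The condition on c is in product form because ℓ can be 0, as at n = 3.
scaled-bound : ∀ {q c α m n ℓ L A N f P} → α * L ≡ A → P * N ≡ f → A * m * N ℚ.≤ ℓ * L * (n * f) →
               0ℚ ℚ.≤ c → 0ℚ ℚ.≤ f → 0ℚ ℚ.< N → 0ℚ ℚ.< L →
               c * (n * ℓ) ℚ.≤ 1ℚ → q ℚ.< α * m * c → q ℚ.< P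
scaled-bound {q} {c} {α} {m} {n} {ℓ} {L} {A} {N} {f} {P} αL≡A PN≡f le 0≤c 0≤f 0<N 0<L cnℓ≤1 q< =
  ℚ.*-cancelʳ-<-nonNeg (N * L) {{ℚ.nonNegative (ℚ.<⇒≤ (*-pos 0<N 0<L))}} (begin-strict
  q * (N * L)             <⟨ ℚ.*-monoˡ-<-pos (N * L) {{ℚ.positive (*-pos 0<N 0<L)}} q< ⟩
  α * m * c * (N * L)     ≡⟨ solve 5 (λ α m c N L → α :* m :* c :* (N :* L) := c :* (α :* L :* m :* N))
      refl α m c N L ⟩
  c * (α * L * m * N)     ≡⟨ cong (λ t → c * (t * m * N)) αL≡A ⟩
  c * (A * m * N)         ≤⟨ *-monoʳ-≤′ 0≤c le ⟩
  c * (ℓ * L * (n * f))   ≡⟨ solve 5 (λ c ℓ L n f → c :* (ℓ :* L :* (n :* f)) := c :* (n :* ℓ) :* (f :* L))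
      refl c ℓ L n f ⟩
  c * (n * ℓ) * (f * L)   ≤⟨ ℚ.*-monoʳ-≤-nonNeg (f * L) {{ℚ.nonNegative (*-nonNeg 0≤f (ℚ.<⇒≤ 0<L))}} cnℓ≤1 ⟩
  1ℚ * (f * L)            ≡⟨ ℚ.*-identityˡ (f * L) ⟩
  f * L                   ≡⟨ cong (_* L) PN≡f ⟨
  P * N * L               ≡⟨ ℚ.*-assoc P N L ⟩
  P * (N * L)             ∎)
  where open ℚ.≤-Reasoning

ι-#found-bound : ∀ {n} .{{_ : NonZero n}} (H : ShiftHint n) s →
  ι (log₂log₂ n ℕ.∸ 4) * ι (suc ⌊log₂ n ⌋) * ι (#permutations n)
  ℚ.≤ ι (log₂log₂ n) * ι (suc (log₂log₂ n)) * (ι n * ι (#found H s))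
ι-#found-bound {n} H s = subst₂ ℚ._≤_ (ι-*₃ (ℓ ℕ.∸ 4) (suc ⌊log₂ n ⌋) (#permutations n))
  (trans (ι-*₃ ℓ (suc ℓ) (n ℕ.* #found H s)) (cong (ι ℓ * ι (suc ℓ) *_) (ι-* n (#found H s))))
  (ι-mono-≤ (#found-bound H s))
  where
  ℓ = log₂log₂ n
  ι-*₃ : ∀ a b c → ι (a ℕ.* b ℕ.* c) ≡ ι a * ι b * ι c
  ι-*₃ a b c = trans (ι-* (a ℕ.* b) c) (cong (_* ι c) (ι-* a b))

-- c approximates 1 / (n log log n) from below, and ⌊log n⌋ + 1 exceeds log n.
<Pr : ∀ {n} .{{_ : NonZero n}} (H : ShiftHint n) s {q c} → 0ℚ ℚ.≤ c →
      c * (ι n * ι (log₂log₂ n)) ℚ.≤ 1ℚ →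
      q ℚ.< (1ℚ + δ n) * ι (suc ⌊log₂ n ⌋) * c →
      q ℚ.< Pr (found? H s)
<Pr {n} H s {q} {c} 0≤c = scaled-bound {q} {c} {1ℚ + δ n} {ι (suc ⌊log₂ n ⌋)} {ι n} {ι (log₂log₂ n)}
  {ι (suc (log₂log₂ n))} {ι (log₂log₂ n ℕ.∸ 4)} {ι (#permutations n)} {ι (#found H s)} {Pr (found? H s)}
  ([1+δ]*ι n) (Pr-*-ι H s) (ι-#found-bound H s) 0≤c (0≤ι (#found H s)) (0<ι-#permutations n) (0<ι-suc (log₂log₂ n))

module _ {n : ℕ} .{{_ : NonZero n}} (3≤n : 3 ≤ n) where

  private
    m = ⌊log₂ n ⌋
    ℓ = log₂log₂ n

    1≤m : 1 ≤ m
    1≤m = 2^k≤n⇒k≤log₂n {1} (ℕ.≤-trans (ℕ.n≤1+n 2) 3≤n)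

  upper-log : ∀ {d} → upper (log₂ (fromℕ n)) d → ι m ℚ.< d
  upper-log = log₂-upper {fromℕ n} {n} {m} (λ n<r → n<r) (2^log₂n≤n n)

  upper-loglog : ∀ {d} → upper (log₂ (log₂ (fromℕ n))) d → ι ℓ ℚ.< d
  upper-loglog = log₂-upper {log₂ (fromℕ n)} {m} {ℓ} upper-log (2^log₂n≤n m {{ℕ.>-nonZero 1≤m}})

  upper-log-pos : ∀ {d} → upper (log₂ (fromℕ n)) d → 0ℚ ℚ.< d
  upper-log-pos y<d = ℚ.≤-<-trans (0≤ι m) (upper-log y<d)

  lower-log : ∀ {c} → lower (log₂ (fromℕ n)) c → c ℚ.≤ ι (suc m)
  lower-log c<y = ℚ.<⇒≤ (log₂-lower {n} {suc m} (ℕ.<⇒≤ (n<2^[1+log₂n] n)) c<y)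

  upper-1+δ-pos : ∀ {b} → upper (fromℚ (1ℚ + δ n)) b → 0ℚ ℚ.< b
  upper-1+δ-pos = ℚ.≤-<-trans (0≤1+δ n)

  Pr-found-≥ : ∀ (H : ShiftHint n) s → fromℚ (Pr (found? H s)) ≥ᴿ
               (fromℚ (1ℚ + δ n) *ᴿ log₂ (fromℕ n)) /ᴿ (fromℕ n *ᴿ log₂ (log₂ (fromℕ n)))
  Pr-found-≥ H s = /ᴿ-≤
    {fromℚ (1ℚ + δ n) *ᴿ log₂ (fromℕ n)} {fromℕ n *ᴿ log₂ (log₂ (fromℕ n))}
    {(1ℚ + δ n) * ι (suc m)} {ι n * ι ℓ} {Pr (found? H s)}
    (0≤Pr H s)
    (*ᴿ-upper-pos {fromℚ (1ℚ + δ n)} {log₂ (fromℕ n)} upper-1+δ-pos upper-log-pos)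
    (*ᴿ-lower-≤ {fromℚ (1ℚ + δ n)} {log₂ (fromℕ n)} {1ℚ + δ n} {ι (suc m)}
      upper-1+δ-pos upper-log-pos (0≤ι (suc m)) ℚ.<⇒≤ lower-log)
    (*ᴿ-upper-≥ {fromℕ n} {log₂ (log₂ (fromℕ n))} {ι n} {ι ℓ}
      (0≤ι n) (0≤ι ℓ) ℚ.<⇒≤ (λ ℓ<d → ℚ.<⇒≤ (upper-loglog ℓ<d)))
    (<Pr H s)

theorem6 : Σ[ δ ∈ (ℕ → ℚ) ] (δ ⟶0) ×
    (∀ (n : ℕ) .{{_ : NonZero n}} → 3 ≤ n → (H : ShiftHint n) (s : Fin n) →
    fromℚ (Pr (found? H s)) ≥ᴿ (fromℚ (1ℚ + δ n) *ᴿ log₂ (fromℕ n)) /ᴿ (fromℕ n *ᴿ log₂ (log₂ (fromℕ n))))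
theorem6 = δ , δ⟶0 , λ n 3≤n → Pr-found-≥ 3≤n
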